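{- Let $\mathcal A\subseteq\mathbb N$ be such that for every $n_1\in\mathbb N$ it is decidable whether there exists $n_2\in\mathcal A$ with $n_1\le n_2$. Then for every environment $L$ and term $T$ it is decidable whether there exists a term $U$ with $L\vdash_{\mathcal A}T:U$.
   Context: Fix a nonempty set $\Sigma$ of sorts with decidable equality, a (computable) function $\mathrm{next}:\Sigma\to\Sigma$, and a countably infinite set of variables with decidable equality. Terms and environments: $T,U,V,W ::= \star s \mid x \mid \mathrm{app}(V,T) \mid \lambda x{:}W.\,T \mid \mathrm{def}(x{=}V).\,T \mid \mathrm{cast}(U,T)$ ($s\in\Sigma$) and $L,K ::= \emptyset \mid K,x{:}W \mid K,x{=}V$. $\mathrm{app}(V,T)$ applies $T$ to $V$; $\lambda x{:}W.\,T$ (de Bruijn's abstraction) and $\mathrm{def}(x{=}V).\,T$ (local definition) bind $x$ in $T$; $\mathrm{cast}(U,T)$ annotates $T$ with expected type $U$; entries $x{:}W$ and $x{=}V$ bind $x$. Terms are modulo renaming of bound variables. Write $\mathsf{B}x[V]$ for either $\lambda x{:}V$ or $\mathrm{def}(x{=}V)$ and correspondingly $L,x[V]$ for $L,x{:}V$ resp. $L,x{=}V$. One step of bound rt-reduction $L\vdash T_1\to^nT_2$ is the smallest relation closed under: $L\vdash\mathrm{app}(V,\lambda x{:}W.\,T)\to^0\mathrm{def}(x{=}\mathrm{cast}(W,V)).\,T$; $K,x{=}V\vdash x\to^0V$; $L\vdash\mathrm{def}(x{=}V).\,T\to^0T$ if $x$ not free in $T$; $L\vdash\mathrm{app}(V,\mathrm{def}(x{=}W).\,T)\to^0\mathrm{def}(x{=}W).\,\mathrm{app}(V,T)$;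 $L\vdash\mathrm{cast}(U,T)\to^0T$; $L\vdash\star s\to^1\star\,\mathrm{next}(s)$; $K,x{:}W\vdash x\to^1W$; $L\vdash\mathrm{cast}(U,T)\to^1U$; if $K\vdash x\to^nT$, $y\neq x$, $y$ not free in $T$ then $K,y[V]\vdash x\to^nT$; if $L\vdash V_1\to^0V_2$ then $L\vdash\mathrm{app}(V_1,T)\to^0\mathrm{app}(V_2,T)$; if $L\vdash T_1\to^nT_2$ then $L\vdash\mathrm{app}(V,T_1)\to^n\mathrm{app}(V,T_2)$; if $L\vdash V_1\to^0V_2$ then $L\vdash\mathsf Bx[V_1].\,T\to^0\mathsf Bx[V_2].\,T$; if $L,x[V]\vdash T_1\to^nT_2$ then $L\vdash\mathsf Bx[V].\,T_1\to^n\mathsf Bx[V].\,T_2$; if $L\vdash U_1\to^0U_2$ then $L\vdash\mathrm{cast}(U_1,T)\to^0\mathrm{cast}(U_2,T)$; if $L\vdash T_1\to^0T_2$ then $L\vdash\mathrm{cast}(U,T_1)\to^0\mathrm{cast}(U,T_2)$; if $L\vdash U_1\to^1U_2$ and $L\vdash T_1\to^1T_2$ then $L\vdash\mathrm{cast}(U_1,T_1)\to^1\mathrm{cast}(U_2,T_2)$. $L\vdash T_1\to^{*n}T_2$ is the smallest relation with $L\vdash T\to^{*0}T$, containing single steps, and with $L\vdash T_1\to^{*n_1}T$, $L\vdash T\to^{*n_2}T_2$ implying $L\vdash T_1\to^{*n_1+n_2}T_2$. Validity $L\vdash_{\mathcal A}T$ is the smallest predicate closed under: $L\vdash_{\mathcal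 A}\star s$; if $K\vdash_{\mathcal A}V$ then $K,x[V]\vdash_{\mathcal A}x$; if $K\vdash_{\mathcal A}x$ and $y\neq x$ then $K,y[V]\vdash_{\mathcal A}x$; if $L\vdash_{\mathcal A}V$ and $L,x[V]\vdash_{\mathcal A}T$ then $L\vdash_{\mathcal A}\mathsf Bx[V].\,T$; if $L\vdash_{\mathcal A}U$, $L\vdash_{\mathcal A}T$ and some $U_0$ satisfies $L\vdash T\to^{*1}U_0$, $L\vdash U\to^{*0}U_0$, then $L\vdash_{\mathcal A}\mathrm{cast}(U,T)$; if $L\vdash_{\mathcal A}V$, $L\vdash_{\mathcal A}T$ and there are $n\in\mathcal A$, $x,W_0,U_0$ with $L\vdash T\to^{*n}\lambda x{:}W_0.\,U_0$ and $L\vdash V\to^{*1}W_0$, then $L\vdash_{\mathcal A}\mathrm{app}(V,T)$. The type judgment $L\vdash_{\mathcal A}T:U$ means $L\vdash_{\mathcal A}\mathrm{cast}(U,T)$. -}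

module Defs where

open import Data.Nat using (ℕ; zero; suc; _+_; _<?_)
open import Data.Product using (Σ; ∃; _×_; _,_)
open import Relation.Nullary using (yes; no)

-- Binders: B x[V] is either an abstraction (λ x:V) or a local definition (def x = V).
data Binder : Set where
  abst : Binder
  abbr : Binder

-- Terms over a set S of sorts, with de Bruijn indices for variables
-- (this realises "terms modulo renaming of bound variables").
module _ {S : Set} where

  data Term : Set where
    sort : S → Term
    var  : ℕ → Term
    app  : Term → Term → Term             -- app(V,T): T applied to V
    bind : Binder → Term → Term → Term    -- B x[V]. T  (binds index 0 in T)
    cast : Term → Term → Term

  data Env : Set where
    ∅     : Env
    _,[_]_ : Env → Binder → Term → Env

  lift : ℕ → Term → Term
  lift k (sort s) = sort s
  lift k (var i) with i <? k
  ... | yes _ = var i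
  ... | no  _ = var (suc i)
  lift k (app V T) = app (lift k V) (lift k T)
  lift k (bind b V T) = bind b (lift k V) (lift (suc k) T)
  lift k (cast U T) = cast (lift k U) (lift k T)

  -- weakening by one entry (the fresh name is not free in the lifted term)
  ↑ : Term → Term
  ↑ = lift 0

module _ {S : Set} (next : S → S) where

  data Step : Env {S} → ℕ → Term → Term → Set where
    β      : ∀ {L V W T} → Step L 0 (app V (bind abst W T)) (bind abbr (cast W V) T)
    δ      : ∀ {K V} → Step (K ,[ abbr ] V) 0 (var 0) (↑ V)
    ζ      : ∀ {L V T} → Step L 0 (bind abbr V (↑ T)) T
    θ      : ∀ {L V W T} → Step L 0 (app V (bind abbr W T)) (bind abbr W (app (↑ V) T))
    ε      : ∀ {L U T} → Step L 0 (cast U T) T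
    srt    : ∀ {L s} → Step L 1 (sort s) (sort (next s))
    ldec   : ∀ {K W} → Step (K ,[ abst ] W) 1 (var 0) (↑ W)
    ee     : ∀ {L U T} → Step L 1 (cast U T) U
    lref   : ∀ {K b V i n T} → Step K n (var i) T → Step (K ,[ b ] V) n (var (suc i)) (↑ T)
    appl   : ∀ {L V₁ V₂ T} → Step L 0 V₁ V₂ → Step L 0 (app V₁ T) (app V₂ T)
    appr   : ∀ {L V T₁ T₂ n} → Step L n T₁ T₂ → Step L n (app V T₁) (app V T₂)
    bindl  : ∀ {L b V₁ V₂ T} → Step L 0 V₁ V₂ → Step L 0 (bind b V₁ T) (bind b V₂ T)
    bindr  : ∀ {L b V T₁ T₂ n} → Step (L ,[ b ] V) n T₁ T₂ → Step L n (bind b V T₁) (bind b V T₂)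
    castl  : ∀ {L U₁ U₂ T} → Step L 0 U₁ U₂ → Step L 0 (cast U₁ T) (cast U₂ T)
    castr  : ∀ {L U T₁ T₂} → Step L 0 T₁ T₂ → Step L 0 (cast U T₁) (cast U T₂)
    cast1  : ∀ {L U₁ U₂ T₁ T₂} → Step L 1 U₁ U₂ → Step L 1 T₁ T₂ →
             Step L 1 (cast U₁ T₁) (cast U₂ T₂)

  data Steps : Env {S} → ℕ → Term → Term → Set where
    refl  : ∀ {L T} → Steps L 0 T T
    step  : ∀ {L n T₁ T₂} → Step L n T₁ T₂ → Steps L n T₁ T₂
    trans : ∀ {L n₁ n₂ T₁ T T₂} → Steps L n₁ T₁ T → Steps L n₂ T T₂ →
            Steps L (n₁ + n₂) T₁ T₂

  data Valid (A : ℕ → Set) : Env {S} → Term → Set where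
    v-sort : ∀ {L s} → Valid A L (sort s)
    v-zero : ∀ {K b V} → Valid A K V → Valid A (K ,[ b ] V) (var 0)
    v-suc  : ∀ {K b V i} → Valid A K (var i) → Valid A (K ,[ b ] V) (var (suc i))
    v-bind : ∀ {L b V T} → Valid A L V → Valid A (L ,[ b ] V) T → Valid A L (bind b V T)
    v-cast : ∀ {L U T} → Valid A L U → Valid A L T →
             (∃ λ U₀ → Steps L 1 T U₀ × Steps L 0 U U₀) → Valid A L (cast U T)
    v-app  : ∀ {L V T} → Valid A L V → Valid A L T →
             (∃ λ n → A n × ∃ λ W₀ → ∃ λ U₀ →
                Steps L n T (bind abst W₀ U₀) × Steps L 1 V W₀) →
             Valid A L (app V T)

  HasType : (ℕ → Set) → Env {S} → Term → Term → Set
  HasType A L T U = Valid A L (cast U T)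

module Submission where

-- Erasing casts and unfolding definitions maps terms to pure λ-terms with abstractions ƛ W T, on
-- which the 1-steps become de Bruijn's function ty, replacing the head variable by its declared
-- type. Let ≃ be the conversion that contracts V ▸ ƛ W T only if ty V ≃ W. Because of this side
-- condition ty commutes with substitution and respects ≃ without any validity assumption, and the
-- restricted reduction is confluent. On valid terms every redex satisfies the side condition (the
-- domains of two convertible abstractions are convertible), so subject reduction follows by a
-- plain induction, with no appeal to termination. The reduction conditions in the definition of
-- validity thus become conversions between translated terms. These are decidable since valid terms
-- have arities (simple types), hence normal forms. Some iterate of ty turns a valid T into a
-- telescope ƛ W₁ … ƛ Wₖ ⋆; for k > 0 the degrees at which T becomes an abstraction form an up-set
-- with a computable least element, where the hypothesis on A applies. Finally a valid term is
-- always typable, since its 1-reducts are valid again.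

open import Defs renaming (refl to s-refl; trans to s-trans)
open import Data.Nat as ℕ using (ℕ; zero; suc; _+_; _∸_; _≤_; _<_; _<?_; z≤n; s≤s)
open import Data.Nat.Properties using (+-comm; +-identityʳ; m∸n+n≡m)
open import Data.Maybe using (Maybe; just; nothing)
open import Data.Product using (∃; ∃-syntax; _×_; _,_; proj₁; proj₂)
open import Data.Sum using (_⊎_; inj₁; inj₂)
open import Data.Empty using (⊥-elim)
open import Function using (_∘_; id)
open import Induction.WellFounded using (Acc; acc)
open import Relation.Nullary using (Dec; yes; no; ¬_)
open import Relation.Nullary.Decidable using (map′; _×-dec_)
open import Relation.Binary.Definitions using (DecidableEquality)
open import Relation.Binary.PropositionalEquality using (_≡_; refl; sym; trans; cong; cong₂; subst; subst₂; module ≡-Reasoning)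
open import Relation.Binary.Construct.Closure.ReflexiveTransitive using (Star; ε; _◅_; _◅◅_; gmap)

-- Pure terms

extN : (ℕ → ℕ) → ℕ → ℕ
extN ρ zero    = zero
extN ρ (suc i) = suc (ρ i)

infixr 7 _•_

_•_ : {X : Set} → X → (ℕ → X) → ℕ → X
(x • f) zero    = x
(x • f) (suc i) = f i

module _ {S : Set} where

  infixr 8 _▸_
  infix 9 _[_]
  infixl 6 _▹_

  data Tm : Set where
    ⋆   : S → Tm
    ν   : ℕ → Tm
    _▸_ : Tm → Tm → Tm
    ƛ   : Tm → Tm → Tm

  Ctx : Set
  Ctx = ℕ → Tm

  ren : (ℕ → ℕ) → Tm → Tm
  ren ρ (⋆ s)   = ⋆ s
  ren ρ (ν i)   = ν (ρ i)
  ren ρ (V ▸ T) = ren ρ V ▸ ren ρ T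
  ren ρ (ƛ W T) = ƛ (ren ρ W) (ren (extN ρ) T)

  wk : Tm → Tm
  wk = ren suc

  exts : (ℕ → Tm) → ℕ → Tm
  exts τ = ν 0 • (wk ∘ τ)

  sub : (ℕ → Tm) → Tm → Tm
  sub τ (⋆ s)   = ⋆ s
  sub τ (ν i)   = τ i
  sub τ (V ▸ T) = sub τ V ▸ sub τ T
  sub τ (ƛ W T) = ƛ (sub τ W) (sub (exts τ) T)

  _[_] : Tm → Tm → Tm
  T [ V ] = sub (V • ν) T

  _▹_ : Ctx → Tm → Ctx
  Γ ▹ W = wk W • (wk ∘ Γ)

  ren-ren : ∀ {ρ ρ′ ρ″} → (∀ i → ρ′ (ρ i) ≡ ρ″ i) → ∀ T → ren ρ′ (ren ρ T) ≡ ren ρ″ T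
  ren-ren e (⋆ s)   = refl
  ren-ren e (ν i)   = cong ν (e i)
  ren-ren e (V ▸ T) = cong₂ _▸_ (ren-ren e V) (ren-ren e T)
  ren-ren {ρ} {ρ′} {ρ″} e (ƛ W T) = cong₂ ƛ (ren-ren e W) (ren-ren e′ T)
    where
    e′ : ∀ i → extN ρ′ (extN ρ i) ≡ extN ρ″ i
    e′ zero    = refl
    e′ (suc i) = cong suc (e i)

  sub-ren : ∀ {ρ τ τ′} → (∀ i → τ (ρ i) ≡ τ′ i) → ∀ T → sub τ (ren ρ T) ≡ sub τ′ T
  sub-ren e (⋆ s)   = refl
  sub-ren e (ν i)   = e i
  sub-ren e (V ▸ T) = cong₂ _▸_ (sub-ren e V) (sub-ren e T)
  sub-ren {ρ} {τ} {τ′} e (ƛ W T) = cong₂ ƛ (sub-ren e W) (sub-ren e′ T)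
    where
    e′ : ∀ i → exts τ (extN ρ i) ≡ exts τ′ i
    e′ zero    = refl
    e′ (suc i) = cong wk (e i)

  ren-wk : ∀ ρ T → ren (extN ρ) (wk T) ≡ wk (ren ρ T)
  ren-wk ρ T = trans (ren-ren (λ _ → refl) T) (sym (ren-ren (λ _ → refl) T))

  ren-sub : ∀ {ρ τ τ′} → (∀ i → ren ρ (τ i) ≡ τ′ i) → ∀ T → ren ρ (sub τ T) ≡ sub τ′ T
  ren-sub e (⋆ s)   = refl
  ren-sub e (ν i)   = e i
  ren-sub e (V ▸ T) = cong₂ _▸_ (ren-sub e V) (ren-sub e T)
  ren-sub {ρ} {τ} {τ′} e (ƛ W T) = cong₂ ƛ (ren-sub e W) (ren-sub e′ T)
    where
    e′ : ∀ i → ren (extN ρ) (exts τ i) ≡ exts τ′ i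
    e′ zero    = refl
    e′ (suc i) = trans (ren-wk ρ (τ i)) (cong wk (e i))

  sub-wk : ∀ τ T → sub (exts τ) (wk T) ≡ wk (sub τ T)
  sub-wk τ T = trans (sub-ren (λ _ → refl) T) (sym (ren-sub (λ _ → refl) T))

  sub-sub : ∀ {τ τ′ τ″} → (∀ i → sub τ′ (τ i) ≡ τ″ i) → ∀ T → sub τ′ (sub τ T) ≡ sub τ″ T
  sub-sub e (⋆ s)   = refl
  sub-sub e (ν i)   = e i
  sub-sub e (V ▸ T) = cong₂ _▸_ (sub-sub e V) (sub-sub e T)
  sub-sub {τ} {τ′} {τ″} e (ƛ W T) = cong₂ ƛ (sub-sub e W) (sub-sub e′ T)
    where
    e′ : ∀ i → sub (exts τ′) (exts τ i) ≡ exts τ″ i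
    e′ zero    = refl
    e′ (suc i) = trans (sub-wk τ′ (τ i)) (cong wk (e i))

  sub-id : ∀ {τ} → (∀ i → τ i ≡ ν i) → ∀ T → sub τ T ≡ T
  sub-id e (⋆ s)   = refl
  sub-id e (ν i)   = e i
  sub-id e (V ▸ T) = cong₂ _▸_ (sub-id e V) (sub-id e T)
  sub-id {τ} e (ƛ W T) = cong₂ ƛ (sub-id e W) (sub-id e′ T)
    where
    e′ : ∀ i → exts τ i ≡ ν i
    e′ zero    = refl
    e′ (suc i) = cong wk (e i)

  wk-[] : ∀ V T → wk T [ V ] ≡ T
  wk-[] V T = trans (sub-ren (λ _ → refl) T) (sub-id (λ _ → refl) T)

  ren-[] : ∀ ρ V T → ren ρ (T [ V ]) ≡ ren (extN ρ) T [ ren ρ V ]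
  ren-[] ρ V T = trans (ren-sub (λ _ → refl) T) (sym (sub-ren e T))
    where
    e : ∀ i → (ren ρ V • ν) (extN ρ i) ≡ ren ρ ((V • ν) i)
    e zero    = refl
    e (suc i) = refl

  sub-[] : ∀ τ V T → sub τ (T [ V ]) ≡ sub (exts τ) T [ sub τ V ]
  sub-[] τ V T = trans (sub-sub (λ _ → refl) T) (sym (sub-sub e T))
    where
    e : ∀ i → sub (sub τ V • ν) (exts τ i) ≡ sub τ ((V • ν) i)
    e zero    = refl
    e (suc i) = wk-[] _ (τ i)

  module _ (_≟_ : DecidableEquality S) where

    infix 4 _≟Tm_

    _≟Tm_ : DecidableEquality Tm
    ⋆ s   ≟Tm ⋆ s′    = map′ (cong ⋆) (λ { refl → refl }) (s ≟ s′)
    ν i   ≟Tm ν j     = map′ (cong ν) (λ { refl → refl }) (i ℕ.≟ j)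
    V ▸ T ≟Tm V′ ▸ T′ = map′ (λ { (refl , refl) → refl }) (λ { refl → refl , refl }) ((V ≟Tm V′) ×-dec (T ≟Tm T′))
    ƛ W T ≟Tm ƛ W′ T′ = map′ (λ { (refl , refl) → refl }) (λ { refl → refl , refl }) ((W ≟Tm W′) ×-dec (T ≟Tm T′))
    ⋆ _   ≟Tm ν _     = no λ ()
    ⋆ _   ≟Tm (_ ▸ _) = no λ ()
    ⋆ _   ≟Tm ƛ _ _   = no λ ()
    ν _   ≟Tm ⋆ _     = no λ ()
    ν _   ≟Tm (_ ▸ _) = no λ ()
    ν _   ≟Tm ƛ _ _   = no λ ()
    (_ ▸ _) ≟Tm ⋆ _   = no λ ()
    (_ ▸ _) ≟Tm ν _   = no λ ()
    (_ ▸ _) ≟Tm ƛ _ _ = no λ ()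
    ƛ _ _ ≟Tm ⋆ _     = no λ ()
    ƛ _ _ ≟Tm ν _     = no λ ()
    ƛ _ _ ≟Tm (_ ▸ _) = no λ ()

-- Restricted conversion and its confluence

module Conversion {S : Set} (next : S → S) where

  infix 4 _⊢_≃_ _⊢_⇒_ _⊢_⇒*_ _⇒ᵣ_ _⇒ₛ_

  ty : Ctx {S} → Tm → Tm
  ty Γ (⋆ s)   = ⋆ (next s)
  ty Γ (ν i)   = Γ i
  ty Γ (V ▸ T) = V ▸ ty Γ T
  ty Γ (ƛ W T) = ƛ W (ty (Γ ▹ W) T)

  -- The side condition of ≃-β makes every axiom compatible with ty, so that ty respects ≃
  -- without any validity assumption.
  data _⊢_≃_ (Γ : Ctx {S}) : Tm → Tm → Set where
    ≃-refl  : ∀ {T} → Γ ⊢ T ≃ T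
    ≃-sym   : ∀ {T U} → Γ ⊢ T ≃ U → Γ ⊢ U ≃ T
    ≃-trans : ∀ {T U X} → Γ ⊢ T ≃ U → Γ ⊢ U ≃ X → Γ ⊢ T ≃ X
    ≃-app   : ∀ {V V′ T T′} → Γ ⊢ V ≃ V′ → Γ ⊢ T ≃ T′ → Γ ⊢ V ▸ T ≃ V′ ▸ T′
    ≃-lam   : ∀ {W W′ T T′} → Γ ⊢ W ≃ W′ → Γ ▹ W ⊢ T ≃ T′ → Γ ⊢ ƛ W T ≃ ƛ W′ T′
    ≃-β     : ∀ {V W T} → Γ ⊢ ty Γ V ≃ W → Γ ⊢ V ▸ ƛ W T ≃ T [ V ]

  ≡⇒≃ : ∀ {Γ T U} → T ≡ U → Γ ⊢ T ≃ U
  ≡⇒≃ refl = ≃-refl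

  _⇒ᵣ_ : Ctx {S} → Ctx {S} → (ℕ → ℕ) → Set
  (Γ ⇒ᵣ Γ′) ρ = ∀ i → Γ′ (ρ i) ≡ ren ρ (Γ i)

  wk-⇒ᵣ : ∀ {Γ W} → (Γ ⇒ᵣ Γ ▹ W) suc
  wk-⇒ᵣ i = refl

  ext-⇒ᵣ : ∀ {Γ Γ′ ρ W} → (Γ ⇒ᵣ Γ′) ρ → (Γ ▹ W ⇒ᵣ Γ′ ▹ ren ρ W) (extN ρ)
  ext-⇒ᵣ {ρ = ρ} {W} m zero    = sym (ren-wk ρ W)
  ext-⇒ᵣ {Γ} {ρ = ρ} m (suc i) = trans (cong wk (m i)) (sym (ren-wk ρ (Γ i)))

  ty-ren : ∀ {Γ Γ′ ρ} → (Γ ⇒ᵣ Γ′) ρ → ∀ T → ty Γ′ (ren ρ T) ≡ ren ρ (ty Γ T)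
  ty-ren m (⋆ s)   = refl
  ty-ren m (ν i)   = m i
  ty-ren m (V ▸ T) = cong (_ ▸_) (ty-ren m T)
  ty-ren m (ƛ W T) = cong (ƛ _) (ty-ren (ext-⇒ᵣ m) T)

  ≃-ren : ∀ {Γ Γ′ ρ T U} → (Γ ⇒ᵣ Γ′) ρ → Γ ⊢ T ≃ U → Γ′ ⊢ ren ρ T ≃ ren ρ U
  ≃-ren m ≃-refl        = ≃-refl
  ≃-ren m (≃-sym p)     = ≃-sym (≃-ren m p)
  ≃-ren m (≃-trans p q) = ≃-trans (≃-ren m p) (≃-ren m q)
  ≃-ren m (≃-app p q)   = ≃-app (≃-ren m p) (≃-ren m q)
  ≃-ren m (≃-lam p q)   = ≃-lam (≃-ren m p) (≃-ren (ext-⇒ᵣ m) q)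
  ≃-ren {Γ′ = Γ′} {ρ} m (≃-β {V} {W} {T} p) =
    ≃-trans (≃-β (subst (λ X → Γ′ ⊢ X ≃ ren ρ W) (sym (ty-ren m V)) (≃-ren m p)))
            (≡⇒≃ (sym (ren-[] ρ V T)))

  ≃-wk : ∀ {Γ W T U} → Γ ⊢ T ≃ U → Γ ▹ W ⊢ wk T ≃ wk U
  ≃-wk {Γ} {W} = ≃-ren (wk-⇒ᵣ {Γ} {W})

  -- Morphisms of contexts. Types have to match only up to conversion, and nothing is asked about
  -- the validity of the terms substituted.
  _⇒ₛ_ : Ctx {S} → Ctx {S} → (ℕ → Tm) → Set
  (Γ ⇒ₛ Γ′) τ = ∀ i → Γ′ ⊢ ty Γ′ (τ i) ≃ sub τ (Γ i)

  exts-⇒ₛ′ : ∀ {Γ Γ′ τ W W′} → (Γ ⇒ₛ Γ′) τ → Γ′ ⊢ W′ ≃ sub τ W → (Γ ▹ W ⇒ₛ Γ′ ▹ W′) (exts τ)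
  exts-⇒ₛ′ {τ = τ} {W} m w zero    = ≃-trans (≃-wk w) (≡⇒≃ (sym (sub-wk τ W)))
  exts-⇒ₛ′ {Γ} {Γ′} {τ} {W} {W′} m w (suc i) =
    ≃-trans (≡⇒≃ (ty-ren (wk-⇒ᵣ {Γ′} {W′}) (τ i)))
            (≃-trans (≃-wk (m i)) (≡⇒≃ (sym (sub-wk τ (Γ i)))))

  exts-⇒ₛ : ∀ {Γ Γ′ τ W} → (Γ ⇒ₛ Γ′) τ → (Γ ▹ W ⇒ₛ Γ′ ▹ sub τ W) (exts τ)
  exts-⇒ₛ m = exts-⇒ₛ′ m ≃-refl

  ty-sub : ∀ {Γ Γ′ τ} → (Γ ⇒ₛ Γ′) τ → ∀ T → Γ′ ⊢ ty Γ′ (sub τ T) ≃ sub τ (ty Γ T)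
  ty-sub m (⋆ s)   = ≃-refl
  ty-sub m (ν i)   = m i
  ty-sub m (V ▸ T) = ≃-app ≃-refl (ty-sub m T)
  ty-sub m (ƛ W T) = ≃-lam ≃-refl (ty-sub (exts-⇒ₛ m) T)

  ≃-sub : ∀ {Γ Γ′ τ T U} → (Γ ⇒ₛ Γ′) τ → Γ ⊢ T ≃ U → Γ′ ⊢ sub τ T ≃ sub τ U
  ≃-sub m ≃-refl        = ≃-refl
  ≃-sub m (≃-sym p)     = ≃-sym (≃-sub m p)
  ≃-sub m (≃-trans p q) = ≃-trans (≃-sub m p) (≃-sub m q)
  ≃-sub m (≃-app p q)   = ≃-app (≃-sub m p) (≃-sub m q)
  ≃-sub m (≃-lam p q)   = ≃-lam (≃-sub m p) (≃-sub (exts-⇒ₛ m) q)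
  ≃-sub {τ = τ} m (≃-β {V} {W} {T} p) =
    ≃-trans (≃-β (≃-trans (ty-sub m V) (≃-sub m p))) (≡⇒≃ (sym (sub-[] τ V T)))

  single-⇒ₛ : ∀ {Γ V W} → Γ ⊢ ty Γ V ≃ W → (Γ ▹ W ⇒ₛ Γ) (V • ν)
  single-⇒ₛ {V = V} {W} p zero = ≃-trans p (≡⇒≃ (sym (wk-[] V W)))
  single-⇒ₛ {Γ} {V} p (suc i)  = ≡⇒≃ (sym (wk-[] V (Γ i)))

  ν-⇒ₛ : ∀ {Γ} → (Γ ⇒ₛ Γ) ν
  ν-⇒ₛ {Γ} i = ≡⇒≃ (sym (sub-id (λ _ → refl) (Γ i)))

  -- The identity substitution, read as a morphism between contexts whose last entries are
  -- convertible. Every change of a declared type below is an instance.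
  conv-⇒ₛ : ∀ {Γ W W′} → Γ ⊢ W ≃ W′ → (Γ ▹ W ⇒ₛ Γ ▹ W′) (exts ν)
  conv-⇒ₛ {W = W} p =
    exts-⇒ₛ′ ν-⇒ₛ (≃-trans (≃-sym p) (≡⇒≃ (sym (sub-id (λ _ → refl) W))))

  exts-ν : ∀ i → exts ν i ≡ ν {S} i
  exts-ν zero    = refl
  exts-ν (suc i) = refl

  ≃-conv : ∀ {Γ W W′ T U} → Γ ⊢ W ≃ W′ → Γ ▹ W ⊢ T ≃ U → Γ ▹ W′ ⊢ T ≃ U
  ≃-conv {T = T} {U} p q = subst₂ (_ ⊢_≃_) (sub-id exts-ν T) (sub-id exts-ν U) (≃-sub (conv-⇒ₛ p) q)

  ty-conv : ∀ {Γ W W′} → Γ ⊢ W ≃ W′ → ∀ T → Γ ▹ W′ ⊢ ty (Γ ▹ W′) T ≃ ty (Γ ▹ W) T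
  ty-conv {Γ} {W} {W′} p T =
    subst₂ (λ X Y → Γ ▹ W′ ⊢ ty (Γ ▹ W′) X ≃ Y) (sub-id exts-ν T) (sub-id exts-ν (ty (Γ ▹ W) T))
           (ty-sub (conv-⇒ₛ p) T)

  ty-≃ : ∀ {Γ T U} → Γ ⊢ T ≃ U → Γ ⊢ ty Γ T ≃ ty Γ U
  ty-≃ ≃-refl        = ≃-refl
  ty-≃ (≃-sym p)     = ≃-sym (ty-≃ p)
  ty-≃ (≃-trans p q) = ≃-trans (ty-≃ p) (ty-≃ q)
  ty-≃ (≃-app p q)   = ≃-app p (ty-≃ q)
  -- The types of the two bodies are computed under different declarations, `W` and `W′`; `ty-conv`
  -- bridges the gap.
  ty-≃ (≃-lam {T′ = T′} p q) = ≃-lam p (≃-trans (ty-≃ q) (≃-sym (≃-conv (≃-sym p) (ty-conv p T′))))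
  -- The side condition `p` is what makes the substitution of `V` a morphism of contexts, so `ty`
  -- commutes with it.
  ty-≃ (≃-β {T = T} p)       = ≃-trans (≃-β p) (≃-sym (ty-sub (single-⇒ₛ p) T))

  -- Parallel reduction and its diamond property

  data _⊢_⇒_ (Γ : Ctx {S}) : Tm → Tm → Set where
    ⇒-⋆ : ∀ {s} → Γ ⊢ ⋆ s ⇒ ⋆ s
    ⇒-ν : ∀ {i} → Γ ⊢ ν i ⇒ ν i
    ⇒-▸ : ∀ {V V′ T T′} → Γ ⊢ V ⇒ V′ → Γ ⊢ T ⇒ T′ → Γ ⊢ V ▸ T ⇒ V′ ▸ T′
    ⇒-ƛ : ∀ {W W′ T T′} → Γ ⊢ W ⇒ W′ → Γ ▹ W ⊢ T ⇒ T′ → Γ ⊢ ƛ W T ⇒ ƛ W′ T′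
    ⇒-β : ∀ {V V′ W T T′} → Γ ⊢ ty Γ V ≃ W → Γ ⊢ V ⇒ V′ → Γ ▹ W ⊢ T ⇒ T′ →
          Γ ⊢ V ▸ ƛ W T ⇒ T′ [ V′ ]

  ⇒-refl : ∀ {Γ} T → Γ ⊢ T ⇒ T
  ⇒-refl (⋆ s)   = ⇒-⋆
  ⇒-refl (ν i)   = ⇒-ν
  ⇒-refl (V ▸ T) = ⇒-▸ (⇒-refl V) (⇒-refl T)
  ⇒-refl (ƛ W T) = ⇒-ƛ (⇒-refl W) (⇒-refl T)

  ⇒⊆≃ : ∀ {Γ T U} → Γ ⊢ T ⇒ U → Γ ⊢ T ≃ U
  ⇒⊆≃ ⇒-⋆         = ≃-refl
  ⇒⊆≃ ⇒-ν         = ≃-refl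
  ⇒⊆≃ (⇒-▸ p q)   = ≃-app (⇒⊆≃ p) (⇒⊆≃ q)
  ⇒⊆≃ (⇒-ƛ p q)   = ≃-lam (⇒⊆≃ p) (⇒⊆≃ q)
  ⇒⊆≃ (⇒-β c p q) =
    -- The redex is contracted after its parts have been reduced, so the side condition must move
    -- from `V` to `V′`.
    ≃-trans (≃-app (⇒⊆≃ p) (≃-lam ≃-refl (⇒⊆≃ q))) (≃-β (≃-trans (≃-sym (ty-≃ (⇒⊆≃ p))) c))

  ⇒-ren : ∀ {Γ Γ′ ρ T U} → (Γ ⇒ᵣ Γ′) ρ → Γ ⊢ T ⇒ U → Γ′ ⊢ ren ρ T ⇒ ren ρ U
  ⇒-ren m ⇒-⋆       = ⇒-⋆
  ⇒-ren m ⇒-ν       = ⇒-ν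
  ⇒-ren m (⇒-▸ p q) = ⇒-▸ (⇒-ren m p) (⇒-ren m q)
  ⇒-ren m (⇒-ƛ p q) = ⇒-ƛ (⇒-ren m p) (⇒-ren (ext-⇒ᵣ m) q)
  ⇒-ren {Γ′ = Γ′} {ρ} m (⇒-β {V} {V′} {W} {T} {T′} c p q) =
    subst (Γ′ ⊢ _ ⇒_) (sym (ren-[] ρ V′ T′))
      (⇒-β (subst (λ X → Γ′ ⊢ X ≃ ren ρ W) (sym (ty-ren m V)) (≃-ren m c))
           (⇒-ren m p) (⇒-ren (ext-⇒ᵣ m) q))

  ⇒-exts : ∀ {Γ W τ τ′} → (∀ i → Γ ⊢ τ i ⇒ τ′ i) → ∀ i → Γ ▹ W ⊢ exts τ i ⇒ exts τ′ i
  ⇒-exts r zero    = ⇒-ν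
  ⇒-exts {Γ} {W} r (suc i) = ⇒-ren (wk-⇒ᵣ {Γ} {W}) (r i)

  ⇒-sub : ∀ {Γ Γ′ τ τ′ T U} → (Γ ⇒ₛ Γ′) τ → (∀ i → Γ′ ⊢ τ i ⇒ τ′ i) → Γ ⊢ T ⇒ U →
          Γ′ ⊢ sub τ T ⇒ sub τ′ U
  ⇒-sub m r ⇒-⋆           = ⇒-⋆
  ⇒-sub m r (⇒-ν {i})     = r i
  ⇒-sub m r (⇒-▸ p q)     = ⇒-▸ (⇒-sub m r p) (⇒-sub m r q)
  ⇒-sub m r (⇒-ƛ p q)     = ⇒-ƛ (⇒-sub m r p) (⇒-sub (exts-⇒ₛ m) (⇒-exts r) q)
  ⇒-sub {Γ′ = Γ′} {τ′ = τ′} m r (⇒-β {V} {V′} {T′ = T′} c p q) =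
    subst (Γ′ ⊢ _ ⇒_) (sym (sub-[] τ′ V′ T′))
      (⇒-β (≃-trans (ty-sub m V) (≃-sub m c)) (⇒-sub m r p) (⇒-sub (exts-⇒ₛ m) (⇒-exts r) q))

  ⇒-conv : ∀ {Γ W W′ T U} → Γ ⊢ W ≃ W′ → Γ ▹ W ⊢ T ⇒ U → Γ ▹ W′ ⊢ T ⇒ U
  ⇒-conv {T = T} {U} p q =
    subst₂ (_ ⊢_⇒_) (sub-id exts-ν T) (sub-id exts-ν U) (⇒-sub (conv-⇒ₛ p) (λ i → ⇒-refl (exts ν i)) q)

  ⇒-[] : ∀ {Γ V V′ W T T′} → Γ ⊢ ty Γ V ≃ W → Γ ⊢ V ⇒ V′ → Γ ▹ W ⊢ T ⇒ T′ → Γ ⊢ T [ V ] ⇒ T′ [ V′ ]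
  ⇒-[] {Γ} {V} {V′} c p q = ⇒-sub (single-⇒ₛ c) r q
    where
    r : ∀ i → Γ ⊢ (V • ν) i ⇒ (V′ • ν) i
    r zero    = p
    r (suc i) = ⇒-ν

  diamond : ∀ {Γ T U₁ U₂} → Γ ⊢ T ⇒ U₁ → Γ ⊢ T ⇒ U₂ → ∃[ X ] Γ ⊢ U₁ ⇒ X × Γ ⊢ U₂ ⇒ X
  diamond ⇒-⋆ ⇒-⋆ = _ , ⇒-⋆ , ⇒-⋆
  diamond ⇒-ν ⇒-ν = _ , ⇒-ν , ⇒-ν
  diamond (⇒-▸ p₁ q₁) (⇒-▸ p₂ q₂) with diamond p₁ p₂ | diamond q₁ q₂
  ... | _ , a₁ , a₂ | _ , b₁ , b₂ = _ , ⇒-▸ a₁ b₁ , ⇒-▸ a₂ b₂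
  diamond (⇒-ƛ p₁ q₁) (⇒-ƛ p₂ q₂) with diamond p₁ p₂ | diamond q₁ q₂
  ... | _ , a₁ , a₂ | _ , b₁ , b₂ =
    _ , ⇒-ƛ a₁ (⇒-conv (⇒⊆≃ p₁) b₁) , ⇒-ƛ a₂ (⇒-conv (⇒⊆≃ p₂) b₂)
  diamond (⇒-β c p₁ q₁) (⇒-β _ p₂ q₂) with diamond p₁ p₂ | diamond q₁ q₂
  ... | _ , a₁ , a₂ | _ , b₁ , b₂ =
    _ , ⇒-[] (≃-trans (≃-sym (ty-≃ (⇒⊆≃ p₁))) c) a₁ b₁ , ⇒-[] (≃-trans (≃-sym (ty-≃ (⇒⊆≃ p₂))) c) a₂ b₂
  -- The side that kept the redex may have reduced both the argument and the annotation. Since `ty`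
  -- respects conversion, its side condition survives and the redex can still be contracted.
  diamond (⇒-β c p₁ q₁) (⇒-▸ p₂ (⇒-ƛ w q₂)) with diamond p₁ p₂ | diamond q₁ q₂
  ... | _ , a₁ , a₂ | _ , b₁ , b₂ =
    _ , ⇒-[] (≃-trans (≃-sym (ty-≃ (⇒⊆≃ p₁))) c) a₁ b₁
      , ⇒-β (≃-trans (≃-sym (ty-≃ (⇒⊆≃ p₂))) (≃-trans c (⇒⊆≃ w))) a₂ (⇒-conv (⇒⊆≃ w) b₂)
  diamond (⇒-▸ p₁ (⇒-ƛ w q₁)) (⇒-β c p₂ q₂) with diamond p₁ p₂ | diamond q₁ q₂
  ... | _ , a₁ , a₂ | _ , b₁ , b₂ =
    _ , ⇒-β (≃-trans (≃-sym (ty-≃ (⇒⊆≃ p₁))) (≃-trans c (⇒⊆≃ w))) a₁ (⇒-conv (⇒⊆≃ w) b₁)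
      , ⇒-[] (≃-trans (≃-sym (ty-≃ (⇒⊆≃ p₂))) c) a₂ b₂

  -- Church-Rosser theorem and inversion of conversions

  _⊢_⇒*_ : Ctx {S} → Tm → Tm → Set
  Γ ⊢ T ⇒* U = Star (Γ ⊢_⇒_) T U

  strip : ∀ {Γ T U₁ U₂} → Γ ⊢ T ⇒ U₁ → Γ ⊢ T ⇒* U₂ → ∃[ X ] Γ ⊢ U₁ ⇒* X × Γ ⊢ U₂ ⇒ X
  strip p ε       = _ , ε , p
  strip p (q ◅ qs) with diamond p q
  ... | _ , a , b with strip b qs
  ... | _ , c , d = _ , a ◅ c , d

  confluence : ∀ {Γ T U₁ U₂} → Γ ⊢ T ⇒* U₁ → Γ ⊢ T ⇒* U₂ → ∃[ X ] Γ ⊢ U₁ ⇒* X × Γ ⊢ U₂ ⇒* X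
  confluence ε       qs = _ , qs , ε
  confluence (p ◅ ps) qs with strip p qs
  ... | _ , a , b with confluence ps a
  ... | _ , c , d = _ , c , b ◅ d

  ⇒*⊆≃ : ∀ {Γ T U} → Γ ⊢ T ⇒* U → Γ ⊢ T ≃ U
  ⇒*⊆≃ ε       = ≃-refl
  ⇒*⊆≃ (p ◅ ps) = ≃-trans (⇒⊆≃ p) (⇒*⊆≃ ps)

  ⇒*-▸ : ∀ {Γ V V′ T T′} → Γ ⊢ V ⇒* V′ → Γ ⊢ T ⇒* T′ → Γ ⊢ V ▸ T ⇒* V′ ▸ T′
  ⇒*-▸ ε       ε       = ε
  ⇒*-▸ ε       (q ◅ qs) = ⇒-▸ (⇒-refl _) q ◅ ⇒*-▸ ε qs
  ⇒*-▸ (p ◅ ps) qs       = ⇒-▸ p (⇒-refl _) ◅ ⇒*-▸ ps qs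

  ⇒*-ƛ : ∀ {Γ W W′ T T′} → Γ ⊢ W ⇒* W′ → Γ ▹ W ⊢ T ⇒* T′ → Γ ⊢ ƛ W T ⇒* ƛ W′ T′
  ⇒*-ƛ ε       ε       = ε
  ⇒*-ƛ (p ◅ ps) ε       = ⇒-ƛ p (⇒-refl _) ◅ ⇒*-ƛ ps ε
  ⇒*-ƛ ps       (q ◅ qs) = ⇒-ƛ (⇒-refl _) q ◅ ⇒*-ƛ ps qs

  ⇒*-conv : ∀ {Γ W W′ T U} → Γ ⊢ W ≃ W′ → Γ ▹ W ⊢ T ⇒* U → Γ ▹ W′ ⊢ T ⇒* U
  ⇒*-conv p ε       = ε
  ⇒*-conv p (q ◅ qs) = ⇒-conv p q ◅ ⇒*-conv p qs

  church-rosser : ∀ {Γ T U} → Γ ⊢ T ≃ U → ∃[ X ] Γ ⊢ T ⇒* X × Γ ⊢ U ⇒* X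
  church-rosser ≃-refl    = _ , ε , ε
  church-rosser (≃-sym p) with church-rosser p
  ... | _ , a , b = _ , b , a
  church-rosser (≃-trans p q) with church-rosser p | church-rosser q
  ... | _ , a , b | _ , c , d with confluence b c
  ... | _ , e , f = _ , a ◅◅ e , d ◅◅ f
  church-rosser (≃-app p q) with church-rosser p | church-rosser q
  ... | _ , a , b | _ , c , d = _ , ⇒*-▸ a c , ⇒*-▸ b d
  church-rosser (≃-lam p q) with church-rosser p | church-rosser q
  ... | _ , a , b | _ , c , d = _ , ⇒*-ƛ a c , ⇒*-ƛ b (⇒*-conv p d)
  church-rosser (≃-β c) = _ , ⇒-β c (⇒-refl _) (⇒-refl _) ◅ ε , ε

  ƛ-⇒* : ∀ {Γ W T X} → Γ ⊢ ƛ W T ⇒* X → ∃[ W′ ] ∃[ T′ ] X ≡ ƛ W′ T′ × Γ ⊢ W ⇒* W′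
  ƛ-⇒* ε               = _ , _ , refl , ε
  ƛ-⇒* (⇒-ƛ p q ◅ ps) with ƛ-⇒* ps
  ... | _ , _ , e , r = _ , _ , e , p ◅ r

  -- Abstractions reduce only to abstractions, with the domains reducing on their own; the common
  -- reduct therefore joins the domains.
  ƛ-injective : ∀ {Γ W W′ T T′} → Γ ⊢ ƛ W T ≃ ƛ W′ T′ → Γ ⊢ W ≃ W′
  ƛ-injective p with church-rosser p
  ... | _ , a , b with ƛ-⇒* a | ƛ-⇒* b
  ... | _ , _ , refl , r | _ , _ , refl , r′ = ≃-trans (⇒*⊆≃ r) (≃-sym (⇒*⊆≃ r′))

  ⋆-⇒* : ∀ {Γ s X} → Γ ⊢ ⋆ s ⇒* X → X ≡ ⋆ s
  ⋆-⇒* ε          = refl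
  ⋆-⇒* (⇒-⋆ ◅ ps) = ⋆-⇒* ps

  ⋆≄ƛ : ∀ {Γ s W T} → ¬ Γ ⊢ ⋆ s ≃ ƛ W T
  ⋆≄ƛ p with church-rosser p
  ... | _ , a , b with ⋆-⇒* a | ƛ-⇒* b
  ... | refl | _ , _ , () , _

-- Arities and normalisation

infixr 6 _⊃_
infix 4 _≼_ _≺_

data Ar : Set where
  ο   : Ar
  _⊃_ : Ar → Ar → Ar

ACtx : Set
ACtx = ℕ → Maybe Ar

-- A suffix of an arity: what is left after dropping some leading arguments.
data _≼_ (b : Ar) : Ar → Set where
  ≼-refl : b ≼ b
  ≼-cod  : ∀ {c a} → b ≼ a → b ≼ c ⊃ a

≼-tail : ∀ {b c a} → b ⊃ c ≼ a → c ≼ a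
≼-tail ≼-refl    = ≼-cod ≼-refl
≼-tail (≼-cod p) = ≼-cod (≼-tail p)

-- `b` is one of the arguments on the spine of `a`, hence a proper subterm; this gives
-- well-foundedness.
_≺_ : Ar → Ar → Set
b ≺ a = ∃[ c ] b ⊃ c ≼ a

≺-acc : ∀ a {b} → b ≺ a → Acc _≺_ b
≺-acc (b ⊃ c) (_ , ≼-refl)  = acc (≺-acc b)
≺-acc (_ ⊃ c) (d , ≼-cod p) = ≺-acc c (d , p)

≺-wellFounded : ∀ a → Acc _≺_ a
≺-wellFounded a = acc (≺-acc a)

module _ {S : Set} where

  infix 4 _⟶_ _↠_ _⊢_∶_

  -- Plain β-reduction, without the side condition of `≃-β`. The two are related on valid terms
  -- only, by `good-⟶`.
  data _⟶_ : Tm {S} → Tm {S} → Set where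
    ⟶-β  : ∀ {V W T} → V ▸ ƛ W T ⟶ T [ V ]
    ⟶-▸ˡ : ∀ {V V′ T} → V ⟶ V′ → V ▸ T ⟶ V′ ▸ T
    ⟶-▸ʳ : ∀ {V T T′} → T ⟶ T′ → V ▸ T ⟶ V ▸ T′
    ⟶-ƛˡ : ∀ {W W′ T} → W ⟶ W′ → ƛ W T ⟶ ƛ W′ T
    ⟶-ƛʳ : ∀ {W T T′} → T ⟶ T′ → ƛ W T ⟶ ƛ W T′

  _↠_ : Tm {S} → Tm {S} → Set
  _↠_ = Star _⟶_

  ↠-▸ : ∀ {V V′ T T′} → V ↠ V′ → T ↠ T′ → V ▸ T ↠ V′ ▸ T′
  ↠-▸ p q = gmap (_▸ _) ⟶-▸ˡ p ◅◅ gmap (_ ▸_) ⟶-▸ʳ q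

  ↠-ƛ : ∀ {W W′ T T′} → W ↠ W′ → T ↠ T′ → ƛ W T ↠ ƛ W′ T′
  ↠-ƛ p q = gmap (λ W → ƛ W _) ⟶-ƛˡ p ◅◅ gmap (ƛ _) ⟶-ƛʳ q

  -- Simple types, except that a bound variable has the arity of its domain itself. A term and its
  -- type thus share one arity (`∶-ty`).
  data _⊢_∶_ (Δ : ACtx) : Tm {S} → Ar → Set where
    ∶-⋆ : ∀ {s} → Δ ⊢ ⋆ s ∶ ο
    ∶-ν : ∀ {i a} → Δ i ≡ just a → Δ ⊢ ν i ∶ a
    ∶-▸ : ∀ {V T a b} → Δ ⊢ V ∶ a → Δ ⊢ T ∶ a ⊃ b → Δ ⊢ V ▸ T ∶ b
    ∶-ƛ : ∀ {W T a b} → Δ ⊢ W ∶ a → just a • Δ ⊢ T ∶ b → Δ ⊢ ƛ W T ∶ a ⊃ b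

  ∶-unique : ∀ {Δ T a b} → Δ ⊢ T ∶ a → Δ ⊢ T ∶ b → a ≡ b
  ∶-unique ∶-⋆ ∶-⋆ = refl
  ∶-unique (∶-ν e) (∶-ν f) with trans (sym e) f
  ... | refl = refl
  ∶-unique (∶-▸ _ q) (∶-▸ _ q′) with ∶-unique q q′
  ... | refl = refl
  ∶-unique (∶-ƛ p q) (∶-ƛ p′ q′) with ∶-unique p p′
  ... | refl = cong (_ ⊃_) (∶-unique q q′)

  ∶-ren : ∀ {Δ Δ′ ρ T a} → (∀ i {b} → Δ i ≡ just b → Δ′ (ρ i) ≡ just b) → Δ ⊢ T ∶ a → Δ′ ⊢ ren ρ T ∶ a
  ∶-ren r ∶-⋆       = ∶-⋆
  ∶-ren r (∶-ν e)   = ∶-ν (r _ e)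
  ∶-ren r (∶-▸ p q) = ∶-▸ (∶-ren r p) (∶-ren r q)
  ∶-ren {Δ} {Δ′} {ρ} r (∶-ƛ {a = a} p q) = ∶-ƛ (∶-ren r p) (∶-ren r′ q)
    where
    r′ : ∀ i {b} → (just a • Δ) i ≡ just b → (just a • Δ′) (extN ρ i) ≡ just b
    r′ zero    = id
    r′ (suc i) = r i

  ∶-wk : ∀ {Δ m T a} → Δ ⊢ T ∶ a → m • Δ ⊢ wk T ∶ a
  ∶-wk = ∶-ren (λ _ e → e)

  ∶-exts : ∀ {Δ Δ′ m τ} → (∀ i {b} → Δ i ≡ just b → Δ′ ⊢ τ i ∶ b) →
           ∀ i {b} → (m • Δ) i ≡ just b → m • Δ′ ⊢ exts τ i ∶ b
  ∶-exts r zero    e = ∶-ν e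
  ∶-exts r (suc i) e = ∶-wk (r i e)

  ∶-sub : ∀ {Δ Δ′ τ T a} → (∀ i {b} → Δ i ≡ just b → Δ′ ⊢ τ i ∶ b) → Δ ⊢ T ∶ a → Δ′ ⊢ sub τ T ∶ a
  ∶-sub r ∶-⋆       = ∶-⋆
  ∶-sub r (∶-ν e)   = r _ e
  ∶-sub r (∶-▸ p q) = ∶-▸ (∶-sub r p) (∶-sub r q)
  ∶-sub r (∶-ƛ p q) = ∶-ƛ (∶-sub r p) (∶-sub (∶-exts r) q)

  ∶-⟶ : ∀ {Δ T U a} → T ⟶ U → Δ ⊢ T ∶ a → Δ ⊢ U ∶ a
  ∶-⟶ {Δ} (⟶-β {V}) (∶-▸ {a = a} p (∶-ƛ _ q)) = ∶-sub r q
    where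
    r : ∀ i {b} → (just a • Δ) i ≡ just b → Δ ⊢ (V • ν) i ∶ b
    r zero    refl = p
    r (suc i) e    = ∶-ν e
  ∶-⟶ (⟶-▸ˡ r) (∶-▸ p q) = ∶-▸ (∶-⟶ r p) q
  ∶-⟶ (⟶-▸ʳ r) (∶-▸ p q) = ∶-▸ p (∶-⟶ r q)
  ∶-⟶ (⟶-ƛˡ r) (∶-ƛ p q) = ∶-ƛ (∶-⟶ r p) q
  ∶-⟶ (⟶-ƛʳ r) (∶-ƛ p q) = ∶-ƛ p (∶-⟶ r q)

  ∶-↠ : ∀ {Δ T U a} → T ↠ U → Δ ⊢ T ∶ a → Δ ⊢ U ∶ a
  ∶-↠ ε        p = p
  ∶-↠ (r ◅ rs) p = ∶-↠ rs (∶-⟶ r p)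

  -- Normal forms and hereditary substitution

  data Ne : Tm {S} → Set
  data Nf : Tm {S} → Set

  data Ne where
    ne-⋆ : ∀ {s} → Ne (⋆ s)
    ne-ν : ∀ {i} → Ne (ν i)
    ne-▸ : ∀ {V T} → Nf V → Ne T → Ne (V ▸ T)

  data Nf where
    nf-ne : ∀ {T} → Ne T → Nf T
    nf-ƛ  : ∀ {W T} → Nf W → Nf T → Nf (ƛ W T)

  ne-ren : ∀ {ρ T} → Ne T → Ne (ren ρ T)
  nf-ren : ∀ {ρ T} → Nf T → Nf (ren ρ T)
  ne-ren ne-⋆       = ne-⋆
  ne-ren ne-ν       = ne-ν
  ne-ren (ne-▸ p q) = ne-▸ (nf-ren p) (ne-ren q)
  nf-ren (nf-ne p)  = nf-ne (ne-ren p)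
  nf-ren (nf-ƛ p q) = nf-ƛ (nf-ren p) (nf-ren q)

  HasNf : Tm {S} → Set
  HasNf T = ∃[ N ] Nf N × T ↠ N

  -- Allowing variables of any arity makes HSub stable under exts.
  HSub : ACtx → ACtx → Ar → (ℕ → Tm) → Set
  HSub Δ Δ′ a τ = ∀ i {b} → Δ i ≡ just b →
    (∃[ j ] τ i ≡ ν j × Δ′ j ≡ just b) ⊎ (b ≡ a × Nf (τ i) × Δ′ ⊢ τ i ∶ a)

  hsub-exts : ∀ {Δ Δ′ a τ m} → HSub Δ Δ′ a τ → HSub (m • Δ) (m • Δ′) a (exts τ)
  hsub-exts h zero    e = inj₁ (zero , refl , e)
  hsub-exts h (suc i) e with h i e
  ... | inj₁ (j , p , q) = inj₁ (suc j , cong wk p , q)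
  ... | inj₂ (p , q , r) = inj₂ (p , nf-ren q , ∶-wk r)

  hsub-∶ : ∀ {Δ Δ′ a τ} → HSub Δ Δ′ a τ → ∀ i {b} → Δ i ≡ just b → Δ′ ⊢ τ i ∶ b
  hsub-∶ h i e with h i e
  ... | inj₁ (j , p , q)    rewrite p = ∶-ν q
  ... | inj₂ (refl , _ , r) = r

  hsub-single : ∀ {Δ V a} → Nf V → Δ ⊢ V ∶ a → HSub (just a • Δ) Δ a (V • ν)
  hsub-single n t zero    refl = inj₂ (refl , n , t)
  hsub-single n t (suc i) e    = inj₁ (i , refl , e)

  -- The head of a neutral term is either kept or replaced by a normal form of arity a; in the
  -- latter case the result has a suffix of a as its arity, so a β-redex it creates has a
  -- smaller argument arity.
  nf-sub : ∀ {Δ Δ′ a τ T b} → Acc _≺_ a → HSub Δ Δ′ a τ → Nf T → Δ ⊢ T ∶ b → HasNf (sub τ T)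
  ne-sub : ∀ {Δ Δ′ a τ T b} → Acc _≺_ a → HSub Δ Δ′ a τ → Ne T → Δ ⊢ T ∶ b →
           (∃[ N ] Ne N × sub τ T ↠ N) ⊎ (∃[ N ] Nf N × sub τ T ↠ N × b ≼ a)
  nf-sub ac h (nf-ne n) t with ne-sub ac h n t
  ... | inj₁ (N , n′ , r)     = N , nf-ne n′ , r
  ... | inj₂ (N , n′ , r , _) = N , n′ , r
  nf-sub ac h (nf-ƛ n m) (∶-ƛ t u) with nf-sub ac h n t | nf-sub ac (hsub-exts h) m u
  ... | N , n′ , r | M , m′ , s = _ , nf-ƛ n′ m′ , ↠-ƛ r s
  ne-sub ac h ne-⋆ ∶-⋆ = inj₁ (_ , ne-⋆ , ε)
  ne-sub ac h (ne-ν {i}) (∶-ν e) with h i e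
  ... | inj₁ (j , p , _)    rewrite p = inj₁ (_ , ne-ν , ε)
  ... | inj₂ (refl , n , _) = inj₂ (_ , n , ε , ≼-refl)
  ne-sub ac h (ne-▸ n m) (∶-▸ t u) with nf-sub ac h n t | ne-sub ac h m u
  ... | N , n′ , r | inj₁ (M , m′ , s) = inj₁ (_ , ne-▸ n′ m′ , ↠-▸ r s)
  ... | N , n′ , r | inj₂ (M , nf-ne m′ , s , _) = inj₁ (_ , ne-▸ n′ m′ , ↠-▸ r s)
  ne-sub (acc rs) h (ne-▸ n m) (∶-▸ t u) | N , n′ , r | inj₂ (ƛ W M , nf-ƛ _ m′ , s , le)
    with ∶-↠ s (∶-sub (hsub-∶ h) u)
  ... | ∶-ƛ _ u′ with nf-sub (rs (_ , le)) (hsub-single n′ (∶-↠ r (∶-sub (hsub-∶ h) t))) m′ u′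
  ... | K , k , q = inj₂ (K , k , ↠-▸ r s ◅◅ (⟶-β ◅ q) , ≼-tail le)

  -- Once function and argument are normal, at most the outermost redex remains, and `nf-sub`
  -- normalises its contractum.
  hasNf : ∀ {Δ T a} → Δ ⊢ T ∶ a → HasNf T
  hasNf ∶-⋆     = _ , nf-ne ne-⋆ , ε
  hasNf (∶-ν e) = _ , nf-ne ne-ν , ε
  hasNf (∶-ƛ t u) with hasNf t | hasNf u
  ... | N , n , r | M , m , s = _ , nf-ƛ n m , ↠-ƛ r s
  hasNf (∶-▸ t u) with hasNf t | hasNf u
  ... | N , n , r | M , nf-ne m , s = _ , nf-ne (ne-▸ n m) , ↠-▸ r s
  ... | N , n , r | ƛ W M , nf-ƛ _ m , s with ∶-↠ s u
  ... | ∶-ƛ _ u′ with nf-sub (≺-wellFounded _) (hsub-single n (∶-↠ r t)) m u′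
  ... | K , k , q = K , k , ↠-▸ r s ◅◅ (⟶-β ◅ q)

-- Pure validity

-- Linear search upwards from `zero`, bounded by the known witness `m`.
least : {P : ℕ → Set} → (∀ n → Dec (P n)) → ∀ m → P m → ∃[ n ] P n × (∀ k → P k → n ≤ k)
least P? zero    p = zero , p , λ _ _ → z≤n
least {P} P? (suc m) p with P? zero
... | yes q = zero , q , λ _ _ → z≤n
... | no ¬q with least (P? ∘ suc) m p
... | n , q , n-least = suc n , q , least′
  where
  least′ : ∀ k → P k → suc n ≤ k
  least′ zero    r = ⊥-elim (¬q r)
  least′ (suc k) r = s≤s (n-least k r)

module Validity {S : Set} (next : S → S) (A : ℕ → Set) where

  open Conversion {S} next

  -- Iterated types and applicability

  ty^ : Ctx {S} → ℕ → Tm → Tm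
  ty^ Γ zero    T = T
  ty^ Γ (suc n) T = ty Γ (ty^ Γ n T)

  ty^-+ : ∀ Γ m n T → ty^ Γ (m + n) T ≡ ty^ Γ m (ty^ Γ n T)
  ty^-+ Γ zero    n T = refl
  ty^-+ Γ (suc m) n T = cong (ty Γ) (ty^-+ Γ m n T)

  ty^-comm : ∀ Γ m n T → ty^ Γ m (ty^ Γ n T) ≡ ty^ Γ n (ty^ Γ m T)
  ty^-comm Γ m n T =
    trans (sym (ty^-+ Γ m n T)) (trans (cong (λ k → ty^ Γ k T) (+-comm m n)) (ty^-+ Γ n m T))

  ty^-⋆ : ∀ Γ n s → ∃[ s′ ] ty^ Γ n (⋆ s) ≡ ⋆ s′
  ty^-⋆ Γ zero    s = s , refl
  ty^-⋆ Γ (suc n) s with ty^-⋆ Γ n s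
  ... | s′ , e = next s′ , cong (ty Γ) e

  ty^-▸ : ∀ Γ n V T → ty^ Γ n (V ▸ T) ≡ V ▸ ty^ Γ n T
  ty^-▸ Γ zero    V T = refl
  ty^-▸ Γ (suc n) V T = cong (ty Γ) (ty^-▸ Γ n V T)

  ty^-ƛ : ∀ Γ n W T → ty^ Γ n (ƛ W T) ≡ ƛ W (ty^ (Γ ▹ W) n T)
  ty^-ƛ Γ zero    W T = refl
  ty^-ƛ Γ (suc n) W T = cong (ty Γ) (ty^-ƛ Γ n W T)

  ty^-≃ : ∀ {Γ T U} n → Γ ⊢ T ≃ U → Γ ⊢ ty^ Γ n T ≃ ty^ Γ n U
  ty^-≃ zero    p = p
  ty^-≃ (suc n) p = ty-≃ (ty^-≃ n p)

  ty^-ren : ∀ {Γ Γ′ ρ} n → (Γ ⇒ᵣ Γ′) ρ → ∀ T → ty^ Γ′ n (ren ρ T) ≡ ren ρ (ty^ Γ n T)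
  ty^-ren zero    m T = refl
  ty^-ren {Γ′ = Γ′} (suc n) m T = trans (cong (ty Γ′) (ty^-ren n m T)) (ty-ren m (ty^ _ n T))

  ty^-sub : ∀ {Γ Γ′ τ} n → (Γ ⇒ₛ Γ′) τ → ∀ T → Γ′ ⊢ ty^ Γ′ n (sub τ T) ≃ sub τ (ty^ Γ n T)
  ty^-sub zero    m T = ≃-refl
  ty^-sub (suc n) m T = ≃-trans (ty-≃ (ty^-sub n m T)) (ty-sub m (ty^ _ n T))

  -- The applicability condition of `v-app` up to conversion: steps of degree `n` become `n`
  -- iterates of `ty`.
  data IsFun (Γ : Ctx {S}) (V T : Tm) : Set where
    is-fun : ∀ n {W U} → A n → Γ ⊢ ty^ Γ n T ≃ ƛ W U → Γ ⊢ ty Γ V ≃ W → IsFun Γ V T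

  isFun-≃ : ∀ {Γ V V′ T T′} → Γ ⊢ V ≃ V′ → Γ ⊢ T ≃ T′ → IsFun Γ V T → IsFun Γ V′ T′
  isFun-≃ p q (is-fun n a f g) =
    is-fun n a (≃-trans (≃-sym (ty^-≃ n q)) f) (≃-trans (≃-sym (ty-≃ p)) g)

  -- The same degree `n` still works: iterates of `ty` commute, and `ty` leaves the domain of an
  -- abstraction unchanged.
  isFun-ty^ : ∀ {Γ V T} m → IsFun Γ V T → IsFun Γ V (ty^ Γ m T)
  isFun-ty^ {Γ} {V} {T} m (is-fun n {W} {U} a f g) =
    is-fun n a (≃-trans (≡⇒≃ (ty^-comm Γ n m T)) (≃-trans (ty^-≃ m f) (≡⇒≃ (ty^-ƛ Γ m W U)))) g

  isFun-sub : ∀ {Γ Γ′ τ V T} → (Γ ⇒ₛ Γ′) τ → IsFun Γ V T → IsFun Γ′ (sub τ V) (sub τ T)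
  isFun-sub {V = V} {T} m (is-fun n a f g) =
    is-fun n a (≃-trans (ty^-sub n m T) (≃-sub m f)) (≃-trans (ty-sub m V) (≃-sub m g))

  -- Applying the missing iterates to each side brings both to degree `m + n` without touching the
  -- domains.
  ƛ-ty^-unique : ∀ {Γ m n T W W′ U U′} → Γ ⊢ ty^ Γ m T ≃ ƛ W U → Γ ⊢ ty^ Γ n T ≃ ƛ W′ U′ → Γ ⊢ W ≃ W′
  ƛ-ty^-unique {Γ} {m} {n} {T} {W} {W′} {U} {U′} p q =
    ƛ-injective (≃-trans (≡⇒≃ (sym (ty^-ƛ Γ n W U)))
      (≃-trans (≃-sym (ty^-≃ n p))
        (≃-trans (≡⇒≃ (ty^-comm Γ n m T))
          (≃-trans (ty^-≃ m q) (≡⇒≃ (ty^-ƛ Γ m W′ U′))))))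

  ⋆-ty^-ƛ : ∀ {Γ m n T s W U} → Γ ⊢ ty^ Γ m T ≃ ⋆ s → ¬ Γ ⊢ ty^ Γ n T ≃ ƛ W U
  ⋆-ty^-ƛ {Γ} {m} {n} {T} {s} {W} {U} p q =
    ⋆≄ƛ (≃-trans (≡⇒≃ (sym (proj₂ (ty^-⋆ Γ n s))))
      (≃-trans (≃-sym (ty^-≃ n p))
        (≃-trans (≡⇒≃ (ty^-comm Γ n m T))
          (≃-trans (ty^-≃ m q) (≡⇒≃ (ty^-ƛ Γ m W U))))))

  -- An abstraction has its domain at degree 0 already, so the domain found at degree `n` is
  -- convertible to it. Hence every redex of a valid term meets the side condition of `≃-β`.
  isFun-ƛ : ∀ {Γ V W T} → IsFun Γ V (ƛ W T) → Γ ⊢ ty Γ V ≃ W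
  isFun-ƛ (is-fun n _ f g) = ≃-trans g (ƛ-ty^-unique {m = n} {n = 0} f ≃-refl)

  -- Validity of pure terms. Variables are accepted unconditionally; the quality of their
  -- declarations is the business of `Sound`.
  data Good (Γ : Ctx {S}) : Tm → Set where
    good-⋆ : ∀ {s} → Good Γ (⋆ s)
    good-ν : ∀ {i} → Good Γ (ν i)
    good-▸ : ∀ {V T} → Good Γ V → Good Γ T → IsFun Γ V T → Good Γ (V ▸ T)
    good-ƛ : ∀ {W T} → Good Γ W → Good (Γ ▹ W) T → Good Γ (ƛ W T)

  good-ren : ∀ {Γ Γ′ ρ T} → (Γ ⇒ᵣ Γ′) ρ → Good Γ T → Good Γ′ (ren ρ T)
  good-ren m good-⋆       = good-⋆
  good-ren m good-ν       = good-ν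
  good-ren {Γ} {Γ′} {ρ} m (good-▸ {V} {T} p q (is-fun n a f g)) =
    good-▸ (good-ren m p) (good-ren m q)
      (is-fun n a (≃-trans (≡⇒≃ (ty^-ren n m T)) (≃-ren m f)) (≃-trans (≡⇒≃ (ty-ren m V)) (≃-ren m g)))
  good-ren m (good-ƛ p q) = good-ƛ (good-ren m p) (good-ren (ext-⇒ᵣ m) q)

  good-wk : ∀ {Γ W T} → Good Γ T → Good (Γ ▹ W) (wk T)
  good-wk {Γ} {W} = good-ren (wk-⇒ᵣ {Γ} {W})

  good-sub : ∀ {Γ Γ′ τ T} → (Γ ⇒ₛ Γ′) τ → (∀ i → Good Γ′ (τ i)) → Good Γ T → Good Γ′ (sub τ T)
  good-sub m g good-⋆         = good-⋆
  good-sub m g good-ν         = g _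
  good-sub m g (good-▸ p q f) = good-▸ (good-sub m g p) (good-sub m g q) (isFun-sub m f)
  good-sub {Γ′ = Γ′} {τ} m g (good-ƛ {W} p q) = good-ƛ (good-sub m g p) (good-sub (exts-⇒ₛ m) g′ q)
    where
    g′ : ∀ i → Good (Γ′ ▹ sub τ W) (exts τ i)
    g′ zero    = good-ν
    g′ (suc i) = good-wk (g i)

  good-[] : ∀ {Γ V W T} → Γ ⊢ ty Γ V ≃ W → Good Γ V → Good (Γ ▹ W) T → Good Γ (T [ V ])
  good-[] {Γ} {V} c p = good-sub (single-⇒ₛ c) g
    where
    g : ∀ i → Good Γ ((V • ν) i)
    g zero    = p
    g (suc i) = good-ν

  good-conv : ∀ {Γ W W′ T} → Γ ⊢ W ≃ W′ → Good (Γ ▹ W) T → Good (Γ ▹ W′) T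
  good-conv {Γ} {W} {W′} {T} p q = subst (Good _) (sub-id exts-ν T) (good-sub (conv-⇒ₛ p) g q)
    where
    g : ∀ i → Good (Γ ▹ W′) (exts ν i)
    g zero    = good-ν
    g (suc i) = good-ν

  -- Subject reduction and inclusion in `≃` are proved together: the conversion of the reduced part
  -- restores the `IsFun` conditions and the context around it.
  good-⟶ : ∀ {Γ T U} → T ⟶ U → Good Γ T → Γ ⊢ T ≃ U × Good Γ U
  good-⟶ ⟶-β (good-▸ p (good-ƛ _ q) f) = ≃-β (isFun-ƛ f) , good-[] (isFun-ƛ f) p q
  good-⟶ (⟶-▸ˡ r) (good-▸ p q f) with good-⟶ r p
  ... | e , p′ = ≃-app e ≃-refl , good-▸ p′ q (isFun-≃ e ≃-refl f)
  good-⟶ (⟶-▸ʳ r) (good-▸ p q f) with good-⟶ r q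
  ... | e , q′ = ≃-app ≃-refl e , good-▸ p q′ (isFun-≃ ≃-refl e f)
  good-⟶ (⟶-ƛˡ r) (good-ƛ p q) with good-⟶ r p
  ... | e , p′ = ≃-lam e ≃-refl , good-ƛ p′ (good-conv e q)
  good-⟶ (⟶-ƛʳ r) (good-ƛ p q) with good-⟶ r q
  ... | e , q′ = ≃-lam ≃-refl e , good-ƛ p q′

  good-↠ : ∀ {Γ T U} → T ↠ U → Good Γ T → Γ ⊢ T ≃ U × Good Γ U
  good-↠ ε        p = ≃-refl , p
  good-↠ (r ◅ rs) p with good-⟶ r p
  ... | e , q with good-↠ rs q
  ... | e′ , q′ = ≃-trans e e′ , q′

  Judged : Ctx {S} → ACtx → Tm → Set
  Judged Γ Δ T = ∃[ a ] Δ ⊢ T ∶ a × Good Γ T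

  judged-wk : ∀ {Γ Δ W m T} → Judged Γ Δ T → Judged (Γ ▹ W) (m • Δ) (wk T)
  judged-wk (a , t , g) = a , ∶-wk t , good-wk g

  -- Telescopes

  data Tele : Tm {S} → Set where
    tele-⋆ : ∀ {s} → Tele (⋆ s)
    tele-ƛ : ∀ {W T} → Tele T → Tele (ƛ W T)

  tele-ren : ∀ {ρ T} → Tele T → Tele (ren ρ T)
  tele-ren tele-⋆     = tele-⋆
  tele-ren (tele-ƛ t) = tele-ƛ (tele-ren t)

  tele-sub : ∀ {τ T} → Tele T → Tele (sub τ T)
  tele-sub tele-⋆     = tele-⋆
  tele-sub (tele-ƛ t) = tele-ƛ (tele-sub t)

  Telic : Ctx {S} → Tm → Set
  Telic Γ T = ∃[ n ] ∃[ X ] Tele X × Γ ⊢ ty^ Γ n T ≃ X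

  telic-wk : ∀ {Γ W T} → Telic Γ T → Telic (Γ ▹ W) (wk T)
  telic-wk {Γ} {W} {T} (n , X , t , p) =
    n , _ , tele-ren t , ≃-trans (≡⇒≃ (ty^-ren n (wk-⇒ᵣ {Γ} {W}) T)) (≃-wk p)

  -- Variables without arity stand for declarations that may be invalid.
  Sound : Ctx {S} → ACtx → Set
  Sound Γ Δ = ∀ i {a} → Δ i ≡ just a → Δ ⊢ Γ i ∶ a × Good Γ (Γ i) × Telic Γ (Γ i)

  sound-ext : ∀ {Γ Δ W a} → Sound Γ Δ → Δ ⊢ W ∶ a → Good Γ W → Telic Γ W → Sound (Γ ▹ W) (just a • Δ)
  sound-ext h t g l zero    refl = ∶-wk t , good-wk g , telic-wk l
  sound-ext h t g l (suc i) e with h i e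
  ... | t′ , g′ , l′ = ∶-wk t′ , good-wk g′ , telic-wk l′

  sound-skip : ∀ {Γ Δ W} → Sound Γ Δ → Sound (Γ ▹ W) (nothing • Δ)
  sound-skip h (suc i) e with h i e
  ... | t′ , g′ , l′ = ∶-wk t′ , good-wk g′ , telic-wk l′

  -- Induction on the arity. A variable needs one degree more than its declared type; the function
  -- of an application reaches an abstraction whose body, a telescope, stays one when the argument
  -- is substituted.
  telic : ∀ {Γ Δ T a} → Sound Γ Δ → Δ ⊢ T ∶ a → Good Γ T → Telic Γ T
  telic h ∶-⋆ good-⋆ = 0 , _ , tele-⋆ , ≃-refl
  telic {Γ} h (∶-ν {i} e) good-ν with proj₂ (proj₂ (h i e))
  ... | n , X , t , p =
    suc n , X , t , ≃-trans (≡⇒≃ (ty^-comm Γ 1 n (ν i))) p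
  telic {Γ} h (∶-ƛ t u) (good-ƛ {W} {T} p q) with telic (sound-ext h t p (telic h t p)) u q
  ... | n , X , l , e = n , _ , tele-ƛ l , ≃-trans (≡⇒≃ (ty^-ƛ Γ n W T)) (≃-lam ≃-refl e)
  telic {Γ} h (∶-▸ t u) (good-▸ {V} {T} p q (is-fun n _ f g)) with telic h u q
  -- A function that reaches a sort can never become an abstraction, against the validity of the
  -- application.
  ... | m , _ , tele-⋆ , e           = ⊥-elim (⋆-ty^-ƛ {m = m} {n} e f)
  ... | m , ƛ W′ X , tele-ƛ l , e =
    m , _ , tele-sub l ,
    ≃-trans (≡⇒≃ (ty^-▸ Γ m V T))
      (≃-trans (≃-app ≃-refl e) (≃-β (≃-trans g (ƛ-ty^-unique {m = n} {m} f e))))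

  -- Arities and validity along `ty` and application

  ∶-ty : ∀ {Γ Δ T a} → (∀ i {b} → Δ i ≡ just b → Δ ⊢ Γ i ∶ b) → Δ ⊢ T ∶ a → Δ ⊢ ty Γ T ∶ a
  ∶-ty h ∶-⋆       = ∶-⋆
  ∶-ty h (∶-ν e)   = h _ e
  ∶-ty h (∶-▸ p q) = ∶-▸ p (∶-ty h q)
  ∶-ty {Γ} {Δ} h (∶-ƛ {W} {a = a} p q) = ∶-ƛ p (∶-ty h′ q)
    where
    h′ : ∀ i {b} → (just a • Δ) i ≡ just b → just a • Δ ⊢ (Γ ▹ W) i ∶ b
    h′ zero    refl = ∶-wk p
    h′ (suc i) e    = ∶-wk (h i e)

  good-ty : ∀ {Γ Δ T a} → (∀ i {b} → Δ i ≡ just b → Good Γ (Γ i)) → Δ ⊢ T ∶ a → Good Γ T → Good Γ (ty Γ T)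
  good-ty h ∶-⋆ good-⋆ = good-⋆
  good-ty h (∶-ν e) good-ν = h _ e
  good-ty h (∶-▸ t u) (good-▸ p q f) = good-▸ p (good-ty h u q) (isFun-ty^ 1 f)
  good-ty {Γ} {Δ} h (∶-ƛ {a = a} t u) (good-ƛ {W} p q) = good-ƛ p (good-ty h′ u q)
    where
    h′ : ∀ i {b} → (just a • Δ) i ≡ just b → Good (Γ ▹ W) ((Γ ▹ W) i)
    h′ zero    e = good-wk p
    h′ (suc i) e = good-wk (h i e)

  judged-ty : ∀ {Γ Δ T} → Sound Γ Δ → Judged Γ Δ T → Judged Γ Δ (ty Γ T)
  judged-ty h (a , t , g) = a , ∶-ty (λ i e → proj₁ (h i e)) t , good-ty (λ i e → proj₁ (proj₂ (h i e))) t g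

  judged-ty^ : ∀ {Γ Δ T} → Sound Γ Δ → ∀ n → Judged Γ Δ T → Judged Γ Δ (ty^ Γ n T)
  judged-ty^ h zero    j = j
  judged-ty^ h (suc n) j = judged-ty h (judged-ty^ h n j)

  ⇒⊆↠ : ∀ {Γ T U} → Γ ⊢ T ⇒ U → T ↠ U
  ⇒⊆↠ ⇒-⋆         = ε
  ⇒⊆↠ ⇒-ν         = ε
  ⇒⊆↠ (⇒-▸ p q)   = ↠-▸ (⇒⊆↠ p) (⇒⊆↠ q)
  ⇒⊆↠ (⇒-ƛ p q)   = ↠-ƛ (⇒⊆↠ p) (⇒⊆↠ q)
  ⇒⊆↠ (⇒-β _ p q) = ↠-▸ (⇒⊆↠ p) (↠-ƛ ε (⇒⊆↠ q)) ◅◅ (⟶-β ◅ ε)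

  ⇒*⊆↠ : ∀ {Γ T U} → Γ ⊢ T ⇒* U → T ↠ U
  ⇒*⊆↠ ε        = ε
  ⇒*⊆↠ (p ◅ ps) = ⇒⊆↠ p ◅◅ ⇒*⊆↠ ps

  -- The terms `W` and `U` of `IsFun` come without an arity, and `≃` need not preserve one. The
  -- arity of the domain is therefore read off common reducts, which inherit theirs from `T` and
  -- `V`.
  judged-▸ : ∀ {Γ Δ V T} → Sound Γ Δ → Judged Γ Δ V → Judged Γ Δ T → IsFun Γ V T → Judged Γ Δ (V ▸ T)
  judged-▸ {Γ} {Δ} {V} {T} h (a , v , gv) (c , t , gt) f@(is-fun n _ p q)
    with church-rosser p
  ... | _ , r , s with ƛ-⇒* s
  ... | W′ , U′ , refl , w with church-rosser (≃-trans q (⇒*⊆≃ w))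
  ... | _ , r′ , s′
    with ∶-↠ (⇒*⊆↠ r) (∶-ty^ n) | ∶-↠ (⇒*⊆↠ r′) (∶-ty (λ i e → proj₁ (h i e)) v)
    where
    ∶-ty^ : ∀ n → Δ ⊢ ty^ Γ n T ∶ c
    ∶-ty^ zero    = t
    ∶-ty^ (suc n) = ∶-ty (λ i e → proj₁ (h i e)) (∶-ty^ n)
  ... | ∶-ƛ tw _ | tx with ∶-unique tx (∶-↠ (⇒*⊆↠ s′) tw)
  ... | refl = _ , ∶-▸ v t , good-▸ gv gt f

  -- Deciding conversion and applicability

  ne-⇒ : ∀ {Γ N X} → Ne N → Γ ⊢ N ⇒ X → X ≡ N
  nf-⇒ : ∀ {Γ N X} → Nf N → Γ ⊢ N ⇒ X → X ≡ N
  ne-⇒ ne-⋆ ⇒-⋆             = refl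
  ne-⇒ ne-ν ⇒-ν             = refl
  ne-⇒ (ne-▸ n m) (⇒-▸ p q) = cong₂ _▸_ (nf-⇒ n p) (ne-⇒ m q)
  nf-⇒ (nf-ne n) p          = ne-⇒ n p
  nf-⇒ (nf-ƛ n m) (⇒-ƛ p q) = cong₂ ƛ (nf-⇒ n p) (nf-⇒ m q)

  nf-⇒* : ∀ {Γ N X} → Nf N → Γ ⊢ N ⇒* X → X ≡ N
  nf-⇒* n ε        = refl
  nf-⇒* n (p ◅ ps) with nf-⇒ n p
  ... | refl = nf-⇒* n ps

  nf-≃ : ∀ {Γ M N} → Nf M → Nf N → Γ ⊢ M ≃ N → M ≡ N
  nf-≃ m n p with church-rosser p
  ... | _ , a , b = trans (sym (nf-⇒* m a)) (nf-⇒* n b)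

  -- Normalisation uses plain β; validity ensures that the normal form is reached within `≃`.
  normalise : ∀ {Γ Δ T} → Judged Γ Δ T → ∃[ N ] Nf N × Γ ⊢ T ≃ N × Judged Γ Δ N
  normalise (a , t , g) with hasNf t
  ... | N , n , r with good-↠ r g
  ... | e , g′ = N , n , e , a , ∶-↠ r t , g′

  ne≄ƛ : ∀ {Γ N W U} → Ne N → ¬ Γ ⊢ N ≃ ƛ W U
  ne≄ƛ n p with church-rosser p
  ... | _ , a , b with ƛ-⇒* b | nf-⇒* (nf-ne n) a
  ne≄ƛ () p | _ , a , b | _ , _ , refl , _ | refl

  -- Replaces an arbitrary domain `W` by the one in the normal form of `T`, which is judged, so that
  -- conversion with it can be decided.
  ƛ-form : ∀ {Γ Δ T W U} → Judged Γ Δ T → Γ ⊢ T ≃ ƛ W U →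
           ∃[ W′ ] ∃[ U′ ] Γ ⊢ T ≃ ƛ W′ U′ × Judged Γ Δ W′
  ƛ-form j q with normalise j
  ... | _ , nf-ne n , p , _ = ⊥-elim (ne≄ƛ n (≃-trans (≃-sym p) q))
  ... | _ , nf-ƛ _ _ , p , _ , ∶-ƛ t _ , good-ƛ g _ = _ , _ , p , _ , t , g

  ƛ-dec : ∀ {Γ Δ T} → Judged Γ Δ T → Dec (∃[ W ] ∃[ U ] Γ ⊢ T ≃ ƛ W U)
  ƛ-dec j with normalise j
  ... | _ , nf-ƛ _ _ , p , _ = yes (_ , _ , p)
  ... | _ , nf-ne n , p , _  = no λ { (_ , _ , q) → ne≄ƛ n (≃-trans (≃-sym p) q) }

  ≃-dec : DecidableEquality S → ∀ {Γ Δ T U} → Judged Γ Δ T → Judged Γ Δ U → Dec (Γ ⊢ T ≃ U)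
  ≃-dec _≟_ j k with normalise j | normalise k
  ... | M , m , p , _ | N , n , q , _ =
    map′ (λ e → ≃-trans p (≃-trans (≡⇒≃ e) (≃-sym q)))
         (λ e → nf-≃ m n (≃-trans (≃-sym p) (≃-trans e q)))
         (_≟Tm_ _≟_ M N)

  -- The degrees n at which ty^ n T is an abstraction form an up-set, and the domain of that
  -- abstraction does not depend on n.
  isFun-dec : DecidableEquality S → (∀ n₁ → Dec (∃ λ n₂ → A n₂ × n₁ ≤ n₂)) →
              ∀ {Γ Δ V T} → Sound Γ Δ → Judged Γ Δ V → Judged Γ Δ T → Dec (IsFun Γ V T)
  isFun-dec _≟_ A-dec {Γ} {Δ} {V} {T} h jv jt@(_ , t , g) with telic h t g
  -- The empty telescope: no degree turns `T` into an abstraction.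
  ... | m , _ , tele-⋆ , e = no λ { (is-fun n _ f _) → ⋆-ty^-ƛ {m = m} {n} e f }
  ... | m , _ , tele-ƛ _ , e with least (λ n → ƛ-dec (judged-ty^ h n jt)) m (_ , _ , e)
  ... | k , (_ , _ , p) , k-least with ƛ-form (judged-ty^ h k jt) p
  ... | W , U , q , jw with A-dec k | ≃-dec _≟_ (judged-ty h jv) jw
  ... | no ¬a | _ = no λ { (is-fun n a f _) → ¬a (n , a , k-least n (_ , _ , f)) }
  ... | _ | no ¬c = no λ { (is-fun n a f c) → ¬c (≃-trans c (ƛ-ty^-unique {m = n} {k} f q)) }
  ... | yes (n , a , k≤n) | yes c =
    yes (is-fun n a
      (≃-trans (≡⇒≃ (trans (cong (λ l → ty^ Γ l T) (sym (m∸n+n≡m k≤n))) (ty^-+ Γ (n ∸ k) k T)))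
        (≃-trans (ty^-≃ (n ∸ k) q) (≡⇒≃ (ty^-ƛ Γ (n ∸ k) W U)))) c)

-- Translation of terms and environments

module _ {S : Set} where

  renT : (ℕ → ℕ) → Term {S} → Term
  renT ρ (sort s)     = sort s
  renT ρ (var i)      = var (ρ i)
  renT ρ (app V T)    = app (renT ρ V) (renT ρ T)
  renT ρ (bind b V T) = bind b (renT ρ V) (renT (extN ρ) T)
  renT ρ (cast U T)   = cast (renT ρ U) (renT ρ T)

  skip : ℕ → ℕ → ℕ
  skip zero    = suc
  skip (suc k) = extN (skip k)

  skip-< : ∀ {k i} → i < k → skip k i ≡ i
  skip-< {suc k} {zero}  _       = refl
  skip-< {suc k} {suc i} (s≤s p) = cong suc (skip-< p)

  skip-≮ : ∀ {k i} → ¬ i < k → skip k i ≡ suc i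
  skip-≮ {zero}          _ = refl
  skip-≮ {suc k} {zero}  p = ⊥-elim (p (s≤s z≤n))
  skip-≮ {suc k} {suc i} p = cong suc (skip-≮ (p ∘ s≤s))

  lift-renT : ∀ k T → lift k T ≡ renT (skip k) T
  lift-renT k (sort s) = refl
  lift-renT k (var i) with i <? k
  ... | yes p = cong var (sym (skip-< p))
  ... | no ¬p = cong var (sym (skip-≮ ¬p))
  lift-renT k (app V T)    = cong₂ app (lift-renT k V) (lift-renT k T)
  lift-renT k (bind b V T) = cong₂ (bind b) (lift-renT k V) (lift-renT (suc k) T)
  lift-renT k (cast U T)   = cong₂ cast (lift-renT k U) (lift-renT k T)

  ↑-renT : ∀ T → ↑ T ≡ renT suc T
  ↑-renT = lift-renT 0

  renT-renT : ∀ {ρ ρ′ ρ″} → (∀ i → ρ′ (ρ i) ≡ ρ″ i) → ∀ T → renT ρ′ (renT ρ T) ≡ renT ρ″ T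
  renT-renT e (sort s)  = refl
  renT-renT e (var i)   = cong var (e i)
  renT-renT e (app V T) = cong₂ app (renT-renT e V) (renT-renT e T)
  renT-renT {ρ} {ρ′} {ρ″} e (bind b V T) = cong₂ (bind b) (renT-renT e V) (renT-renT e′ T)
    where
    e′ : ∀ i → extN ρ′ (extN ρ i) ≡ extN ρ″ i
    e′ zero    = refl
    e′ (suc i) = cong suc (e i)
  renT-renT e (cast U T) = cong₂ cast (renT-renT e U) (renT-renT e T)

  renT-id : ∀ {ρ} → (∀ i → ρ i ≡ i) → ∀ T → renT ρ T ≡ T
  renT-id e (sort s)  = refl
  renT-id e (var i)   = cong var (e i)
  renT-id e (app V T) = cong₂ app (renT-id e V) (renT-id e T)
  renT-id {ρ} e (bind b V T) = cong₂ (bind b) (renT-id e V) (renT-id e′ T)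
    where
    e′ : ∀ i → extN ρ i ≡ i
    e′ zero    = refl
    e′ (suc i) = cong suc (e i)
  renT-id e (cast U T) = cong₂ cast (renT-id e U) (renT-id e T)

  renT-↑ : ∀ ρ T → renT (extN ρ) (↑ T) ≡ ↑ (renT ρ T)
  renT-↑ ρ T = begin
    renT (extN ρ) (↑ T)         ≡⟨ cong (renT (extN ρ)) (↑-renT T) ⟩
    renT (extN ρ) (renT suc T)  ≡⟨ renT-renT (λ _ → refl) T ⟩
    renT (suc ∘ ρ) T            ≡⟨ renT-renT (λ _ → refl) T ⟨
    renT suc (renT ρ T)         ≡⟨ ↑-renT (renT ρ T) ⟨
    ↑ (renT ρ T)                ∎
    where open ≡-Reasoning

  -- Under this translation the steps `δ`, `ζ`, `θ` and `ε` become equalities; among the rules of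
  -- degree 0 that contract, only `β` needs a conversion.
  ⟦_⟧ : Term {S} → (ℕ → Tm {S}) → Tm
  ⟦ sort s ⟧        σ = ⋆ s
  ⟦ var i ⟧         σ = σ i
  ⟦ app V T ⟧       σ = ⟦ V ⟧ σ ▸ ⟦ T ⟧ σ
  ⟦ bind abst W T ⟧ σ = ƛ (⟦ W ⟧ σ) (⟦ T ⟧ (exts σ))
  ⟦ bind abbr V T ⟧ σ = ⟦ T ⟧ (⟦ V ⟧ σ • σ)
  ⟦ cast U T ⟧      σ = ⟦ T ⟧ σ

  ⟦renT⟧ : ∀ {ρ σ σ′} → (∀ i → σ (ρ i) ≡ σ′ i) → ∀ T → ⟦ renT ρ T ⟧ σ ≡ ⟦ T ⟧ σ′
  ⟦renT⟧ e (sort s)  = refl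
  ⟦renT⟧ e (var i)   = e i
  ⟦renT⟧ e (app V T) = cong₂ _▸_ (⟦renT⟧ e V) (⟦renT⟧ e T)
  ⟦renT⟧ {ρ} {σ} {σ′} e (bind abst W T) = cong₂ ƛ (⟦renT⟧ e W) (⟦renT⟧ e′ T)
    where
    e′ : ∀ i → exts σ (extN ρ i) ≡ exts σ′ i
    e′ zero    = refl
    e′ (suc i) = cong wk (e i)
  ⟦renT⟧ {ρ} {σ} {σ′} e (bind abbr V T) = ⟦renT⟧ e′ T
    where
    e′ : ∀ i → (⟦ renT ρ V ⟧ σ • σ) (extN ρ i) ≡ (⟦ V ⟧ σ′ • σ′) i
    e′ zero    = ⟦renT⟧ e V
    e′ (suc i) = e i
  ⟦renT⟧ e (cast U T) = ⟦renT⟧ e T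

  ren-⟦⟧ : ∀ {ρ σ σ′} → (∀ i → ren ρ (σ i) ≡ σ′ i) → ∀ T → ren ρ (⟦ T ⟧ σ) ≡ ⟦ T ⟧ σ′
  ren-⟦⟧ e (sort s)  = refl
  ren-⟦⟧ e (var i)   = e i
  ren-⟦⟧ e (app V T) = cong₂ _▸_ (ren-⟦⟧ e V) (ren-⟦⟧ e T)
  ren-⟦⟧ {ρ} {σ} {σ′} e (bind abst W T) = cong₂ ƛ (ren-⟦⟧ e W) (ren-⟦⟧ e′ T)
    where
    e′ : ∀ i → ren (extN ρ) (exts σ i) ≡ exts σ′ i
    e′ zero    = refl
    e′ (suc i) = trans (ren-wk ρ (σ i)) (cong wk (e i))
  ren-⟦⟧ {ρ} {σ} {σ′} e (bind abbr V T) = ren-⟦⟧ e′ T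
    where
    e′ : ∀ i → ren ρ ((⟦ V ⟧ σ • σ) i) ≡ (⟦ V ⟧ σ′ • σ′) i
    e′ zero    = ren-⟦⟧ e V
    e′ (suc i) = e i
  ren-⟦⟧ e (cast U T) = ren-⟦⟧ e T

  sub-⟦⟧ : ∀ {τ σ σ′} → (∀ i → sub τ (σ i) ≡ σ′ i) → ∀ T → sub τ (⟦ T ⟧ σ) ≡ ⟦ T ⟧ σ′
  sub-⟦⟧ e (sort s)  = refl
  sub-⟦⟧ e (var i)   = e i
  sub-⟦⟧ e (app V T) = cong₂ _▸_ (sub-⟦⟧ e V) (sub-⟦⟧ e T)
  sub-⟦⟧ {τ} {σ} {σ′} e (bind abst W T) = cong₂ ƛ (sub-⟦⟧ e W) (sub-⟦⟧ e′ T)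
    where
    e′ : ∀ i → sub (exts τ) (exts σ i) ≡ exts σ′ i
    e′ zero    = refl
    e′ (suc i) = trans (sub-wk τ (σ i)) (cong wk (e i))
  sub-⟦⟧ {τ} {σ} {σ′} e (bind abbr V T) = sub-⟦⟧ e′ T
    where
    e′ : ∀ i → sub τ ((⟦ V ⟧ σ • σ) i) ≡ (⟦ V ⟧ σ′ • σ′) i
    e′ zero    = sub-⟦⟧ e V
    e′ (suc i) = e i
  sub-⟦⟧ e (cast U T) = sub-⟦⟧ e T

  ⟦↑⟧ : ∀ {X : Tm} σ T → ⟦ ↑ T ⟧ (X • σ) ≡ ⟦ T ⟧ σ
  ⟦↑⟧ σ T = trans (cong (λ U → ⟦ U ⟧ _) (↑-renT T)) (⟦renT⟧ (λ _ → refl) T)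

  ⟦↑⟧-exts : ∀ σ T → ⟦ ↑ T ⟧ (exts σ) ≡ wk (⟦ T ⟧ σ)
  ⟦↑⟧-exts σ T = trans (⟦↑⟧ (wk ∘ σ) T) (sym (ren-⟦⟧ (λ _ → refl) T))

  -- Reads a pure term back. The renaming makes room for the definitions, which have an index in the
  -- environment but none in the pure context.
  emb : (ℕ → ℕ) → Tm {S} → Term {S}
  emb e (⋆ s)   = sort s
  emb e (ν i)   = var (e i)
  emb e (V ▸ T) = app (emb e V) (emb e T)
  emb e (ƛ W T) = bind abst (emb e W) (emb (extN e) T)

  emb-ren : ∀ {e ρ e′} → (∀ i → e (ρ i) ≡ e′ i) → ∀ T → emb e (ren ρ T) ≡ emb e′ T
  emb-ren p (⋆ s)   = refl
  emb-ren p (ν i)   = cong var (p i)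
  emb-ren p (V ▸ T) = cong₂ app (emb-ren p V) (emb-ren p T)
  emb-ren {e} {ρ} {e′} p (ƛ W T) = cong₂ (bind abst) (emb-ren p W) (emb-ren p′ T)
    where
    p′ : ∀ i → extN e (extN ρ i) ≡ extN e′ i
    p′ zero    = refl
    p′ (suc i) = cong suc (p i)

  renT-emb : ∀ {ρ e e′} → (∀ i → ρ (e i) ≡ e′ i) → ∀ T → renT ρ (emb e T) ≡ emb e′ T
  renT-emb p (⋆ s)   = refl
  renT-emb p (ν i)   = cong var (p i)
  renT-emb p (V ▸ T) = cong₂ app (renT-emb p V) (renT-emb p T)
  renT-emb {ρ} {e} {e′} p (ƛ W T) = cong₂ (bind abst) (renT-emb p W) (renT-emb p′ T)
    where
    p′ : ∀ i → extN ρ (extN e i) ≡ extN e′ i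
    p′ zero    = refl
    p′ (suc i) = cong suc (p i)

  ⟦emb⟧ : ∀ {e σ τ} → (∀ i → σ (e i) ≡ τ i) → ∀ T → ⟦ emb e T ⟧ σ ≡ sub τ T
  ⟦emb⟧ p (⋆ s)   = refl
  ⟦emb⟧ p (ν i)   = p i
  ⟦emb⟧ p (V ▸ T) = cong₂ _▸_ (⟦emb⟧ p V) (⟦emb⟧ p T)
  ⟦emb⟧ {e} {σ} {τ} p (ƛ W T) = cong₂ ƛ (⟦emb⟧ p W) (⟦emb⟧ p′ T)
    where
    p′ : ∀ i → exts σ (extN e i) ≡ exts τ i
    p′ zero    = refl
    p′ (suc i) = cong wk (p i)

module Translation {S : Set} (next : S → S) (A : ℕ → Set) (s₀ : S) where

  open Conversion {S} next
  open Validity {S} next A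

  -- Simulation of pure reduction by steps

  Sim : (ℕ → ℕ) → Env {S} → Env {S} → Set
  Sim ρ L L′ = ∀ {n i T} → Step next L n (var i) T → Step next L′ n (var (ρ i)) (renT ρ T)

  sim-ext : ∀ {ρ L L′ b V} → Sim ρ L L′ → Sim (extN ρ) (L ,[ b ] V) (L′ ,[ b ] renT ρ V)
  sim-ext {ρ} {V = V} m δ       = subst (Step next _ 0 (var 0)) (sym (renT-↑ ρ V)) δ
  sim-ext {ρ} {V = V} m ldec    = subst (Step next _ 1 (var 0)) (sym (renT-↑ ρ V)) ldec
  sim-ext {ρ} m (lref {T = T} s) = subst (Step next _ _ _) (sym (renT-↑ ρ T)) (lref (m s))

  sim-suc : ∀ {L b V} → Sim suc L (L ,[ b ] V)
  sim-suc {T = T} s = subst (Step next _ _ _) (↑-renT T) (lref s)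

  step-ren : ∀ {ρ L L′ n T U} → Sim ρ L L′ → Step next L n T U → Step next L′ n (renT ρ T) (renT ρ U)
  step-ren m β                 = β
  step-ren m s@δ               = m s
  step-ren {ρ} m (ζ {V = V} {T}) = subst (λ X → Step next _ 0 (bind abbr (renT ρ V) X) (renT ρ T)) (sym (renT-↑ ρ T)) ζ
  step-ren {ρ} m (θ {V = V} {W} {T}) =
    subst (λ X → Step next _ 0 (app (renT ρ V) (renT ρ (bind abbr W T))) (bind abbr (renT ρ W) (app X (renT (extN ρ) T))))
      (sym (renT-↑ ρ V)) θ
  step-ren m ε                 = ε
  step-ren m srt               = srt
  step-ren m s@ldec            = m s
  step-ren m ee                = ee
  step-ren m s@(lref _)        = m s
  step-ren m (appl s)          = appl (step-ren m s)
  step-ren m (appr s)          = appr (step-ren m s)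
  step-ren m (bindl s)         = bindl (step-ren m s)
  step-ren m (bindr s)         = bindr (step-ren (sim-ext m) s)
  step-ren m (castl s)         = castl (step-ren m s)
  step-ren m (castr s)         = castr (step-ren m s)
  step-ren m (cast1 s t)       = cast1 (step-ren m s) (step-ren m t)

  steps-map : ∀ {L L′} {f : Term {S} → Term} → (∀ {n T U} → Step next L n T U → Step next L′ n (f T) (f U)) →
              ∀ {n T U} → Steps next L n T U → Steps next L′ n (f T) (f U)
  steps-map g s-refl        = s-refl
  steps-map g (step s)      = step (g s)
  steps-map g (s-trans s t) = s-trans (steps-map g s) (steps-map g t)

  -- For the positions that admit degree 0 only. The equation on `n` lets the degree of a composite
  -- be split into two zeros.
  steps-map₀ : ∀ {L L′} {f : Term {S} → Term} → (∀ {T U} → Step next L 0 T U → Step next L′ 0 (f T) (f U)) →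
               ∀ {n T U} → n ≡ 0 → Steps next L n T U → Steps next L′ 0 (f T) (f U)
  steps-map₀ g e s-refl      = s-refl
  steps-map₀ g refl (step s) = step (g s)
  steps-map₀ g e (s-trans {n₁ = zero} s t) = s-trans (steps-map₀ g refl s) (steps-map₀ g e t)

  steps-↑ : ∀ {L b V n T U} → Steps next L n T U → Steps next (L ,[ b ] V) n (↑ T) (↑ U)
  steps-↑ {T = T} {U} s =
    subst₂ (Steps next _ _) (sym (↑-renT T)) (sym (↑-renT U)) (steps-map (step-ren sim-suc) s)

  -- Variables out of scope get the junk declaration ⋆ s₀; OK excludes them.
  Γ⟨_⟩ : Env {S} → Ctx {S}
  σ⟨_⟩ : Env {S} → ℕ → Tm {S}
  Γ⟨ ∅ ⟩            = λ _ → ⋆ s₀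
  Γ⟨ L ,[ abst ] W ⟩ = Γ⟨ L ⟩ ▹ ⟦ W ⟧ σ⟨ L ⟩
  Γ⟨ L ,[ abbr ] V ⟩ = Γ⟨ L ⟩
  σ⟨ ∅ ⟩            = ν
  σ⟨ L ,[ abst ] W ⟩ = exts σ⟨ L ⟩
  σ⟨ L ,[ abbr ] V ⟩ = ⟦ V ⟧ σ⟨ L ⟩ • σ⟨ L ⟩

  ⟦_∣_⟧ : Env {S} → Term {S} → Tm
  ⟦ L ∣ T ⟧ = ⟦ T ⟧ σ⟨ L ⟩

  -- The variables of Γ⟨ L ⟩ are the declarations of L, without its definitions.
  index : Env {S} → ℕ → ℕ
  index ∅              = id
  index (L ,[ abst ] W) = extN (index L)
  index (L ,[ abbr ] V) = suc ∘ index L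

  ↓ : Env {S} → Tm {S} → Term
  ↓ L = emb (index L)

  ↑-↓ : ∀ L T → ↑ (↓ L T) ≡ emb (suc ∘ index L) T
  ↑-↓ L T = trans (↑-renT (↓ L T)) (renT-emb (λ _ → refl) T)

  ↑-↓-abst : ∀ L T → ↑ (↓ L T) ≡ emb (extN (index L)) (wk T)
  ↑-↓-abst L T = trans (↑-↓ L T) (sym (emb-ren (λ _ → refl) T))

  Unfolds : Env {S} → Term {S} → Set
  Unfolds L T = Steps next L 0 T (↓ L ⟦ L ∣ T ⟧)

  unfold-suc : ∀ {L} b {V i} → Unfolds L (var i) → Unfolds (L ,[ b ] V) (var (suc i))
  unfold-suc {L} abst {i = i} u = subst (Steps next _ 0 _) (↑-↓-abst L (σ⟨ L ⟩ i)) (steps-↑ u)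
  unfold-suc {L} abbr {V} {i} u = subst (Steps next _ 0 _) (↑-↓ L (σ⟨ L ⟩ i)) (steps-↑ u)

  unfold-zero : ∀ {L V} → Unfolds L V → Unfolds (L ,[ abbr ] V) (var 0)
  unfold-zero {L} {V} u =
    s-trans (step δ) (subst (Steps next _ 0 _) (↑-↓ L ⟦ L ∣ V ⟧) (steps-↑ u))

  unfold′ : ∀ {L} → (∀ i → Unfolds L (var i)) → ∀ T → Unfolds L T
  unfold′ h (sort s)  = s-refl
  unfold′ h (var i)   = h i
  unfold′ h (app V T) = s-trans (steps-map₀ appl refl (unfold′ h V)) (steps-map appr (unfold′ h T))
  unfold′ {L} h (bind abst W T) =
    s-trans (steps-map bindr (unfold′ h′ T)) (steps-map₀ bindl refl (unfold′ h W))
    where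
    h′ : ∀ i → Unfolds (L ,[ abst ] W) (var i)
    h′ zero    = s-refl
    h′ (suc i) = unfold-suc abst (h i)
  unfold′ {L} h (bind abbr V T) =
    s-trans (steps-map bindr (unfold′ h′ T))
      -- The unfolded body no longer mentions the defined variable, since `index` skips it; so `ζ`
      -- drops the definition.
      (step (subst (λ X → Step next L 0 (bind abbr V X) (↓ L ⟦ L ∣ bind abbr V T ⟧))
                   (↑-↓ L ⟦ L ∣ bind abbr V T ⟧) (ζ {T = ↓ L ⟦ L ∣ bind abbr V T ⟧})))
    where
    h′ : ∀ i → Unfolds (L ,[ abbr ] V) (var i)
    h′ zero    = unfold-zero (unfold′ h V)
    h′ (suc i) = unfold-suc abbr (h i)
  unfold′ h (cast U T) = s-trans (step ε) (unfold′ h T)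

  unfold-var : ∀ L i → Unfolds L (var i)
  unfold-var ∅               i       = s-refl
  unfold-var (L ,[ abst ] W) zero    = s-refl
  unfold-var (L ,[ abbr ] V) zero    = unfold-zero (unfold′ (unfold-var L) V)
  unfold-var (L ,[ b ] V)    (suc i) = unfold-suc b (unfold-var L i)

  unfold : ∀ L T → Unfolds L T
  unfold L = unfold′ (unfold-var L)

  σ-index : ∀ L i → σ⟨ L ⟩ (index L i) ≡ ν i
  σ-index ∅               i       = refl
  σ-index (L ,[ abst ] W) zero    = refl
  σ-index (L ,[ abst ] W) (suc i) = cong wk (σ-index L i)
  σ-index (L ,[ abbr ] V) i       = σ-index L i

  -- A pure β-step becomes the rule `β`, after which unfolding eliminates the new local definition
  -- and its cast.
  ↓-⟶ : ∀ {L T U} → T ⟶ U → Steps next L 0 (↓ L T) (↓ L U)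
  ↓-⟶ {L} (⟶-β {V} {W} {T}) =
    s-trans (step β) (subst (λ X → Steps next L 0 contractum (↓ L X)) (⟦emb⟧ e T) (unfold L contractum))
    where
    contractum : Term
    contractum = bind abbr (cast (↓ L W) (↓ L V)) (emb (extN (index L)) T)
    e : ∀ i → (⟦ L ∣ ↓ L V ⟧ • σ⟨ L ⟩) (extN (index L) i) ≡ (V • ν) i
    e zero    = trans (⟦emb⟧ (σ-index L) V) (sub-id (λ _ → refl) V)
    e (suc i) = σ-index L i
  ↓-⟶ (⟶-▸ˡ r) = steps-map₀ appl refl (↓-⟶ r)
  ↓-⟶ (⟶-▸ʳ r) = steps-map appr (↓-⟶ r)
  ↓-⟶ (⟶-ƛˡ r) = steps-map₀ bindl refl (↓-⟶ r)
  ↓-⟶ {L} (⟶-ƛʳ {W} r) = steps-map bindr (↓-⟶ {L ,[ abst ] ↓ L W} r)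

  ↓-↠ : ∀ {L T U} → T ↠ U → Steps next L 0 (↓ L T) (↓ L U)
  ↓-↠ ε        = s-refl
  ↓-↠ (r ◅ rs) = s-trans (↓-⟶ r) (↓-↠ rs)

  -- Validity with its reduction conditions replaced by conversions of translations; `valid⇒ok` and
  -- `ok⇒valid` show that it is equivalent to `Valid`.
  data OK : Env {S} → Term {S} → Set where
    ok-sort : ∀ {L s} → OK L (sort s)
    ok-zero : ∀ {L b V} → OK L V → OK (L ,[ b ] V) (var 0)
    ok-suc  : ∀ {L b V i} → OK L (var i) → OK (L ,[ b ] V) (var (suc i))
    ok-bind : ∀ {L b V T} → OK L V → OK (L ,[ b ] V) T → OK L (bind b V T)
    ok-cast : ∀ {L U T} → OK L U → OK L T → Γ⟨ L ⟩ ⊢ ty Γ⟨ L ⟩ ⟦ L ∣ T ⟧ ≃ ⟦ L ∣ U ⟧ → OK L (cast U T)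
    ok-app  : ∀ {L V T} → OK L V → OK L T → IsFun Γ⟨ L ⟩ ⟦ L ∣ V ⟧ ⟦ L ∣ T ⟧ → OK L (app V T)

  ⟦⟧-≃ : ∀ {Γ σ σ′} → (∀ i → Γ ⊢ σ i ≃ σ′ i) → ∀ T → Γ ⊢ ⟦ T ⟧ σ ≃ ⟦ T ⟧ σ′
  ⟦⟧-≃ h (sort s)  = ≃-refl
  ⟦⟧-≃ h (var i)   = h i
  ⟦⟧-≃ h (app V T) = ≃-app (⟦⟧-≃ h V) (⟦⟧-≃ h T)
  ⟦⟧-≃ {Γ} {σ} {σ′} h (bind abst W T) = ≃-lam (⟦⟧-≃ h W) (⟦⟧-≃ h′ T)
    where
    h′ : ∀ i → Γ ▹ ⟦ W ⟧ σ ⊢ exts σ i ≃ exts σ′ i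
    h′ zero    = ≃-refl
    h′ (suc i) = ≃-wk (h i)
  ⟦⟧-≃ {Γ} {σ} {σ′} h (bind abbr V T) = ⟦⟧-≃ h′ T
    where
    h′ : ∀ i → Γ ⊢ (⟦ V ⟧ σ • σ) i ≃ (⟦ V ⟧ σ′ • σ′) i
    h′ zero    = ⟦⟧-≃ h V
    h′ (suc i) = h i
  ⟦⟧-≃ h (cast U T) = ⟦⟧-≃ h T

  -- Transports OK L (renT ρ T) to OK L′ (renT ρ′ T): having a renaming on both sides covers
  -- weakening, strengthening and the replacement of environment entries at once.
  Mor : (L L′ : Env {S}) (ρ ρ′ : ℕ → ℕ) (τ : ℕ → Tm {S}) → Set
  Mor L L′ ρ ρ′ τ =
    (Γ⟨ L ⟩ ⇒ₛ Γ⟨ L′ ⟩) τ ×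
    (∀ i → Γ⟨ L′ ⟩ ⊢ sub τ (σ⟨ L ⟩ (ρ i)) ≃ σ⟨ L′ ⟩ (ρ′ i)) ×
    (∀ i → OK L (var (ρ i)) → OK L′ (var (ρ′ i)))

  mor-⟦⟧ : ∀ {L L′ ρ ρ′ τ} → Mor L L′ ρ ρ′ τ → ∀ T →
           Γ⟨ L′ ⟩ ⊢ sub τ ⟦ L ∣ renT ρ T ⟧ ≃ ⟦ L′ ∣ renT ρ′ T ⟧
  mor-⟦⟧ {τ = τ} (_ , h , _) T =
    ≃-trans (≡⇒≃ (trans (cong (sub τ) (⟦renT⟧ (λ _ → refl) T)) (sub-⟦⟧ (λ _ → refl) T)))
            (≃-trans (⟦⟧-≃ h T) (≡⇒≃ (sym (⟦renT⟧ (λ _ → refl) T))))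

  extsᵇ : Binder → (ℕ → Tm {S}) → ℕ → Tm {S}
  extsᵇ abst = exts
  extsᵇ abbr = id

  mor-ext : ∀ {L L′ ρ ρ′ τ V V′} b → Mor L L′ ρ ρ′ τ → Γ⟨ L′ ⟩ ⊢ sub τ ⟦ L ∣ V ⟧ ≃ ⟦ L′ ∣ V′ ⟧ →
            (OK L V → OK L′ V′) → Mor (L ,[ b ] V) (L′ ,[ b ] V′) (extN ρ) (extN ρ′) (extsᵇ b τ)
  mor-ext {L} {L′} {ρ} {ρ′} {τ} {V} {V′} b (t , h , k) e f = typed b , equal b , ok
    where
    typed : ∀ b → (Γ⟨ L ,[ b ] V ⟩ ⇒ₛ Γ⟨ L′ ,[ b ] V′ ⟩) (extsᵇ b τ)
    typed abst = exts-⇒ₛ′ t (≃-sym e)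
    typed abbr = t
    equal : ∀ b i → Γ⟨ L′ ,[ b ] V′ ⟩ ⊢ sub (extsᵇ b τ) (σ⟨ L ,[ b ] V ⟩ (extN ρ i)) ≃ σ⟨ L′ ,[ b ] V′ ⟩ (extN ρ′ i)
    equal abst zero    = ≃-refl
    equal abst (suc i) = ≃-trans (≡⇒≃ (sub-wk τ (σ⟨ L ⟩ (ρ i)))) (≃-wk (h i))
    equal abbr zero    = e
    equal abbr (suc i) = h i
    ok : ∀ i → OK (L ,[ b ] V) (var (extN ρ i)) → OK (L′ ,[ b ] V′) (var (extN ρ′ i))
    ok zero    (ok-zero p) = ok-zero (f p)
    ok (suc i) (ok-suc p)  = ok-suc (k i p)

  ok-mor : ∀ {L L′ ρ ρ′ τ} → Mor L L′ ρ ρ′ τ → ∀ T → OK L (renT ρ T) → OK L′ (renT ρ′ T)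
  ok-mor m (sort s)     ok-sort       = ok-sort
  ok-mor m (var i)      p             = proj₂ (proj₂ m) i p
  ok-mor m (app V T)    (ok-app p q f) =
    ok-app (ok-mor m V p) (ok-mor m T q) (isFun-≃ (mor-⟦⟧ m V) (mor-⟦⟧ m T) (isFun-sub (proj₁ m) f))
  ok-mor m (bind b V T) (ok-bind p q) =
    ok-bind (ok-mor m V p) (ok-mor (mor-ext b m (mor-⟦⟧ m V) (ok-mor m V)) T q)
  ok-mor {L} {ρ = ρ} m (cast U T) (ok-cast p q e) =
    ok-cast (ok-mor m U p) (ok-mor m T q)
      (≃-trans (ty-≃ (≃-sym (mor-⟦⟧ m T)))
        (≃-trans (ty-sub (proj₁ m) ⟦ L ∣ renT ρ T ⟧) (≃-trans (≃-sub (proj₁ m) e) (mor-⟦⟧ m U))))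

  ≃-ν : ∀ {Γ} T → Γ ⊢ sub ν T ≃ T
  ≃-ν T = ≡⇒≃ (sub-id (λ _ → refl) T)

  mor-id : ∀ {L} → Mor L L id id ν
  mor-id {L} = ν-⇒ₛ , (λ i → ≃-ν (σ⟨ L ⟩ i)) , (λ _ p → p)

  -- The rule `β` keeps the body and only turns its declaration into a definition, hence the
  -- identity renamings; the pure side substitutes the argument.
  mor-β : ∀ {L V W} → Γ⟨ L ⟩ ⊢ ty Γ⟨ L ⟩ ⟦ L ∣ V ⟧ ≃ ⟦ L ∣ W ⟧ → OK L (cast W V) →
          Mor (L ,[ abst ] W) (L ,[ abbr ] cast W V) id id (⟦ L ∣ V ⟧ • ν)
  mor-β {L} {V} {W} c p = single-⇒ₛ c , equal , ok
    where
    equal : ∀ i → Γ⟨ L ⟩ ⊢ sub (⟦ L ∣ V ⟧ • ν) (exts σ⟨ L ⟩ i) ≃ (⟦ L ∣ V ⟧ • σ⟨ L ⟩) i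
    equal zero    = ≃-refl
    equal (suc i) = ≡⇒≃ (wk-[] _ (σ⟨ L ⟩ i))
    ok : ∀ i → OK (L ,[ abst ] W) (var i) → OK (L ,[ abbr ] cast W V) (var i)
    ok zero    _          = ok-zero p
    ok (suc i) (ok-suc q) = ok-suc q

  wk-as-sub : ∀ T → sub (ν ∘ suc) T ≡ wk {S} T
  wk-as-sub T = trans (sym (sub-ren (λ _ → refl) T)) (sub-id (λ _ → refl) (wk T))

  mor-abst : ∀ {L W} → Mor L (L ,[ abst ] W) id suc (ν ∘ suc)
  mor-abst {L} = (λ i → ≡⇒≃ (sym (wk-as-sub (Γ⟨ L ⟩ i)))) , (λ i → ≡⇒≃ (wk-as-sub (σ⟨ L ⟩ i))) , λ _ → ok-suc

  mor-abbr : ∀ {L V} → Mor L (L ,[ abbr ] V) id suc ν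
  mor-abbr {L} = ν-⇒ₛ , (λ i → ≃-ν (σ⟨ L ⟩ i)) , λ _ → ok-suc

  -- Strengthening: the renaming `suc` on the left restricts the transport to terms that avoid the
  -- defined variable.
  mor-ζ : ∀ {L V} → Mor (L ,[ abbr ] V) L suc id ν
  mor-ζ {L} = ν-⇒ₛ , (λ i → ≃-ν (σ⟨ L ⟩ i)) , λ { _ (ok-suc p) → p }

  ok-↑ : ∀ {L b V T} → OK L T → OK (L ,[ b ] V) (↑ T)
  ok-↑ {b = abst} {T = T} p =
    subst (OK _) (sym (↑-renT T)) (ok-mor mor-abst T (subst (OK _) (sym (renT-id (λ _ → refl) T)) p))
  ok-↑ {b = abbr} {T = T} p =
    subst (OK _) (sym (↑-renT T)) (ok-mor mor-abbr T (subst (OK _) (sym (renT-id (λ _ → refl) T)) p))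

  ok-↓ : ∀ {L V T} → OK (L ,[ abbr ] V) (↑ T) → OK L T
  ok-↓ {T = T} p = subst (OK _) (renT-id (λ _ → refl) T) (ok-mor mor-ζ T (subst (OK _) (↑-renT T) p))

  ok-β : ∀ {L V W T} → Γ⟨ L ⟩ ⊢ ty Γ⟨ L ⟩ ⟦ L ∣ V ⟧ ≃ ⟦ L ∣ W ⟧ → OK L (cast W V) →
         OK (L ,[ abst ] W) T → OK (L ,[ abbr ] cast W V) T
  ok-β {T = T} c p q =
    subst (OK _) (renT-id (λ _ → refl) T) (ok-mor (mor-β c p) T (subst (OK _) (sym (renT-id (λ _ → refl) T)) q))

  ok-entry : ∀ {L b V V′ T} → Γ⟨ L ⟩ ⊢ ⟦ L ∣ V ⟧ ≃ ⟦ L ∣ V′ ⟧ → OK L V′ →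
             OK (L ,[ b ] V) T → OK (L ,[ b ] V′) T
  ok-entry {L} {b} {V} {T = T} e p q =
    subst (OK _) (renT-id extN-id T)
      (ok-mor (mor-ext b mor-id (≃-trans (≃-ν ⟦ L ∣ V ⟧) e) (λ _ → p)) T
        (subst (OK _) (sym (renT-id extN-id T)) q))
    where
    extN-id : ∀ i → extN id i ≡ i
    extN-id zero    = refl
    extN-id (suc i) = refl

  ⟦bind⟧-≃ : ∀ {L V V′} b T → Γ⟨ L ⟩ ⊢ ⟦ L ∣ V ⟧ ≃ ⟦ L ∣ V′ ⟧ → Γ⟨ L ⟩ ⊢ ⟦ L ∣ bind b V T ⟧ ≃ ⟦ L ∣ bind b V′ T ⟧
  ⟦bind⟧-≃ abst T e = ≃-lam e ≃-refl
  ⟦bind⟧-≃ {L} {V} {V′} abbr T e = ⟦⟧-≃ h T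
    where
    h : ∀ i → Γ⟨ L ⟩ ⊢ (⟦ L ∣ V ⟧ • σ⟨ L ⟩) i ≃ (⟦ L ∣ V′ ⟧ • σ⟨ L ⟩) i
    h zero    = e
    h (suc i) = ≃-refl

  ≃-β⟦⟧ : ∀ {L V W} T → Γ⟨ L ⟩ ⊢ ty Γ⟨ L ⟩ ⟦ L ∣ V ⟧ ≃ ⟦ L ∣ W ⟧ → OK L (cast W V) →
          Γ⟨ L ⟩ ⊢ ⟦ L ∣ app V (bind abst W T) ⟧ ≃ ⟦ L ∣ bind abbr (cast W V) T ⟧
  ≃-β⟦⟧ {L} {V} {W} T c p =
    ≃-trans (≃-β c)
      (subst (λ X → Γ⟨ L ⟩ ⊢ sub (⟦ L ∣ V ⟧ • ν) ⟦ L ,[ abst ] W ∣ X ⟧ ≃ ⟦ L ,[ abbr ] cast W V ∣ X ⟧)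
        (renT-id (λ _ → refl) T) (mor-⟦⟧ (mor-β c p) T))

  -- Subject reduction, together with the fact that a step of degree `n` computes `ty^ n` up to
  -- conversion. The second half re-establishes the side conditions needed by the first.
  preserve : ∀ {L n T U} → OK L T → Step next L n T U → OK L U × Γ⟨ L ⟩ ⊢ ty^ Γ⟨ L ⟩ n ⟦ L ∣ T ⟧ ≃ ⟦ L ∣ U ⟧
  preserve (ok-app p (ok-bind q r) f) (β {T = T}) =
    ok-bind (ok-cast q p (isFun-ƛ f)) (ok-β (isFun-ƛ f) (ok-cast q p (isFun-ƛ f)) r) ,
    ≃-β⟦⟧ T (isFun-ƛ f) (ok-cast q p (isFun-ƛ f))
  preserve (ok-zero p) (δ {K} {V}) = ok-↑ p , ≡⇒≃ (sym (⟦↑⟧ σ⟨ K ⟩ V))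
  preserve {L} (ok-bind p q) (ζ {T = T}) = ok-↓ q , ≡⇒≃ (⟦↑⟧ σ⟨ L ⟩ T)
  preserve {L} (ok-app p (ok-bind q r) f) (θ {V = V} {T = T}) =
    ok-bind q (ok-app (ok-↑ p) r (isFun-≃ (≃-sym e) ≃-refl f)) , ≃-app (≃-sym e) ≃-refl
    where
    e : ∀ {X} → Γ⟨ L ⟩ ⊢ ⟦ ↑ V ⟧ (X • σ⟨ L ⟩) ≃ ⟦ L ∣ V ⟧
    e = ≡⇒≃ (⟦↑⟧ σ⟨ L ⟩ V)
  preserve (ok-cast p q e) ε  = q , ≃-refl
  preserve ok-sort srt        = ok-sort , ≃-refl
  preserve (ok-zero p) (ldec {K} {W}) = ok-↑ p , ≡⇒≃ (sym (⟦↑⟧-exts σ⟨ K ⟩ W))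
  preserve (ok-cast p q e) ee = p , e
  preserve (ok-suc p) (lref {K} {abst} {V} {i} {n} {T} s) with preserve p s
  ... | q , e = ok-↑ q ,
    ≃-trans (≡⇒≃ (ty^-ren n (wk-⇒ᵣ {Γ⟨ K ⟩} {⟦ K ∣ V ⟧}) (σ⟨ K ⟩ i)))
      (≃-trans (≃-wk e) (≡⇒≃ (sym (⟦↑⟧-exts σ⟨ K ⟩ T))))
  preserve (ok-suc p) (lref {K} {abbr} {T = T} s) with preserve p s
  ... | q , e = ok-↑ q , ≃-trans e (≡⇒≃ (sym (⟦↑⟧ σ⟨ K ⟩ T)))
  preserve (ok-app p q f) (appl s) with preserve p s
  ... | p′ , e = ok-app p′ q (isFun-≃ e ≃-refl f) , ≃-app e ≃-refl
  preserve {L} (ok-app p q f) (appr {V = V} {T₁} {n = n} s) with preserve q s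
  -- The function moves up by `n` degrees, and applicability is stable under `ty^`.
  ... | q′ , e = ok-app p q′ (isFun-≃ ≃-refl e (isFun-ty^ n f)) ,
    ≃-trans (≡⇒≃ (ty^-▸ Γ⟨ L ⟩ n ⟦ L ∣ V ⟧ ⟦ L ∣ T₁ ⟧)) (≃-app ≃-refl e)
  preserve {L} (ok-bind p q) (bindl {b = b} {V} {T = T} s) with preserve p s
  ... | p′ , e = ok-bind p′ (ok-entry e p′ q) , ⟦bind⟧-≃ {L} {V} b T e
  preserve {L} (ok-bind p q) (bindr {b = abst} {W} {T} {n = n} s) with preserve q s
  ... | q′ , e = ok-bind p q′ ,
    ≃-trans (≡⇒≃ (ty^-ƛ Γ⟨ L ⟩ n ⟦ L ∣ W ⟧ ⟦ L ,[ abst ] W ∣ T ⟧)) (≃-lam ≃-refl e)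
  preserve (ok-bind p q) (bindr {b = abbr} s) with preserve q s
  ... | q′ , e = ok-bind p q′ , e
  preserve (ok-cast p q e) (castl s) with preserve p s
  ... | p′ , e′ = ok-cast p′ q (≃-trans e e′) , ≃-refl
  preserve (ok-cast p q e) (castr s) with preserve q s
  ... | q′ , e′ = ok-cast p q′ (≃-trans (ty-≃ (≃-sym e′)) e) , e′
  preserve (ok-cast p q e) (cast1 s t) with preserve p s | preserve q t
  -- Both sides gain one degree, so the old condition is typed once more by `ty-≃`.
  ... | p′ , d | q′ , d′ = ok-cast p′ q′ (≃-trans (ty-≃ (≃-trans (≃-sym d′) e)) d) , d′

  preserve* : ∀ {L n T U} → OK L T → Steps next L n T U → OK L U × Γ⟨ L ⟩ ⊢ ty^ Γ⟨ L ⟩ n ⟦ L ∣ T ⟧ ≃ ⟦ L ∣ U ⟧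
  preserve* p s-refl   = p , ≃-refl
  preserve* p (step s) = preserve p s
  preserve* {L} {T = T} p (s-trans {n₁ = m} {n} s t) with preserve* p s
  ... | q , d with preserve* q t
  ... | r , e = r ,
    ≃-trans (≡⇒≃ (trans (cong (λ k → ty^ Γ⟨ L ⟩ k ⟦ L ∣ T ⟧) (+-comm m n)) (ty^-+ Γ⟨ L ⟩ n m ⟦ L ∣ T ⟧)))
      (≃-trans (ty^-≃ n d) e)

  -- Equivalence of `OK` and `Valid`

  valid⇒ok : ∀ {L T} → Valid next A L T → OK L T
  valid⇒ok v-sort       = ok-sort
  valid⇒ok (v-zero p)   = ok-zero (valid⇒ok p)
  valid⇒ok (v-suc p)    = ok-suc (valid⇒ok p)
  valid⇒ok (v-bind p q) = ok-bind (valid⇒ok p) (valid⇒ok q)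
  valid⇒ok (v-cast p q (_ , s , t)) =
    ok-cast (valid⇒ok p) (valid⇒ok q)
      (≃-trans (proj₂ (preserve* (valid⇒ok q) s)) (≃-sym (proj₂ (preserve* (valid⇒ok p) t))))
  valid⇒ok (v-app p q (n , a , _ , _ , s , t)) =
    ok-app (valid⇒ok p) (valid⇒ok q)
      (is-fun n a (proj₂ (preserve* (valid⇒ok q) s)) (proj₂ (preserve* (valid⇒ok p) t)))

  -- Supplies actual steps realising `ty`; `OK` rules out variables without an entry, which cannot
  -- step.
  progress : ∀ {L T} → OK L T → ∃[ U ] Steps next L 1 T U
  progress ok-sort     = _ , step srt
  progress (ok-zero {b = abst} p) = _ , step ldec
  progress (ok-zero {b = abbr} p) with progress p
  ... | _ , s = _ , s-trans (step δ) (steps-↑ s)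
  progress (ok-suc p)  with progress p
  ... | _ , s = _ , steps-↑ s
  progress (ok-bind _ q) with progress q
  ... | _ , s = _ , steps-map bindr s
  progress (ok-cast _ _ _) = _ , step ee
  progress (ok-app _ q _) with progress q
  ... | _ , s = _ , steps-map appr s

  progress^ : ∀ {L T} n → OK L T → ∃[ U ] Steps next L n T U
  progress^ zero    p = _ , s-refl
  progress^ (suc n) p with progress p
  ... | _ , s with progress^ n (proj₁ (preserve* p s))
  ... | _ , t = _ , s-trans s t

  steps-⇒* : ∀ {L n T U X} → Steps next L n T U → Γ⟨ L ⟩ ⊢ ⟦ L ∣ U ⟧ ⇒* X → Steps next L n T (↓ L X)
  steps-⇒* {L} {n} {U = U} s r =
    subst (λ k → Steps next L k _ _) (+-identityʳ n) (s-trans s (s-trans (unfold L U) (↓-↠ (⇒*⊆↠ r))))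

  -- The given reducts only spend the degrees `m` and `n`. Their translations are convertible, and a
  -- common pure reduct is reached from both by steps of degree 0.
  joinable : ∀ {L m n T U T′ U′} → OK L T → OK L U → Steps next L m T T′ → Steps next L n U U′ →
             Γ⟨ L ⟩ ⊢ ty^ Γ⟨ L ⟩ m ⟦ L ∣ T ⟧ ≃ ty^ Γ⟨ L ⟩ n ⟦ L ∣ U ⟧ →
             ∃[ X ] Steps next L m T X × Steps next L n U X
  joinable p q s t e
    with church-rosser (≃-trans (≃-sym (proj₂ (preserve* p s))) (≃-trans e (proj₂ (preserve* q t))))
  ... | _ , r , r′ = _ , steps-⇒* s r , steps-⇒* t r′

  ok⇒valid : ∀ {L T} → OK L T → Valid next A L T
  ok⇒valid ok-sort       = v-sort
  ok⇒valid (ok-zero p)   = v-zero (ok⇒valid p)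
  ok⇒valid (ok-suc p)    = v-suc (ok⇒valid p)
  ok⇒valid (ok-bind p q) = v-bind (ok⇒valid p) (ok⇒valid q)
  ok⇒valid (ok-cast p q e) = v-cast (ok⇒valid p) (ok⇒valid q) (joinable q p (proj₂ (progress q)) s-refl e)
  ok⇒valid {L} (ok-app {V = V} {T} p q (is-fun n a f g)) with progress^ n q | progress p
  ... | T′ , s | V′ , t with church-rosser (≃-trans (≃-sym f) (proj₂ (preserve* q s)))
  ... | _ , r , r′ with ƛ-⇒* r
  ... | W′ , U′ , refl , w
    -- `v-app` wants one domain for both reductions: `W′` and the degree-1 reduct of `V` are joined
    -- in `X`, and the former is reduced under the abstraction.
    with church-rosser (≃-trans (≃-sym (≃-trans g (⇒*⊆≃ w))) (proj₂ (preserve* p t)))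
  ... | X , u , u′ = v-app (ok⇒valid p) (ok⇒valid q)
    (n , a , _ , _ , steps-⇒* s (r′ ◅◅ ⇒*-ƛ u ε) , steps-⇒* t u′)

  -- Decidability of `OK`.

  -- The knowledge carried by the decision procedure: L is arbitrary, so each entry comes with a
  -- decision of its validity, and only the valid declarations get an arity.
  Inv : Env {S} → ACtx → Set
  Inv L Δ = Sound Γ⟨ L ⟩ Δ ×
            (∀ i → Dec (OK L (var i))) ×
            (∀ i → OK L (var i) → Judged Γ⟨ L ⟩ Δ (σ⟨ L ⟩ i))

  dec-ext : ∀ {L V b} → Dec (OK L V) → (∀ i → Dec (OK L (var i))) → ∀ i → Dec (OK (L ,[ b ] V) (var i))
  dec-ext d ds zero    = map′ ok-zero (λ { (ok-zero p) → p }) d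
  dec-ext d ds (suc i) = map′ ok-suc (λ { (ok-suc p) → p }) (ds i)

  judged-σ-abst : ∀ {L W Δ m} → (OK L W → ∃[ a ] m ≡ just a) →
                  (∀ i → OK L (var i) → Judged Γ⟨ L ⟩ Δ (σ⟨ L ⟩ i)) →
                  ∀ i → OK (L ,[ abst ] W) (var i) → Judged Γ⟨ L ,[ abst ] W ⟩ (m • Δ) (exts σ⟨ L ⟩ i)
  judged-σ-abst h j zero    (ok-zero p) with h p
  ... | a , e = a , ∶-ν e , good-ν
  judged-σ-abst h j (suc i) (ok-suc p) = judged-wk (j i p)

  judged-σ-abbr : ∀ {L V Δ} → (OK L V → Judged Γ⟨ L ⟩ Δ ⟦ L ∣ V ⟧) →
                  (∀ i → OK L (var i) → Judged Γ⟨ L ⟩ Δ (σ⟨ L ⟩ i)) →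
                  ∀ i → OK (L ,[ abbr ] V) (var i) → Judged Γ⟨ L ⟩ Δ ((⟦ L ∣ V ⟧ • σ⟨ L ⟩) i)
  judged-σ-abbr h j zero    (ok-zero p) = h p
  judged-σ-abbr h j (suc i) (ok-suc p)  = j i p

  inv-ext : ∀ {L Δ V} b → Inv L Δ → OK L V → Judged Γ⟨ L ⟩ Δ ⟦ L ∣ V ⟧ → ∃[ Δ′ ] Inv (L ,[ b ] V) Δ′
  inv-ext abst (h , d , j) p (a , t , g) =
    _ , sound-ext h t g (telic h t g) , dec-ext (yes p) d , judged-σ-abst (λ _ → a , refl) j
  inv-ext abbr (h , d , j) p k = _ , h , dec-ext (yes p) d , judged-σ-abbr (λ _ → k) j

  inv-skip : ∀ {L Δ V} b → Inv L Δ → ¬ OK L V → ∃[ Δ′ ] Inv (L ,[ b ] V) Δ′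
  inv-skip abst (h , d , j) ¬p =
    _ , sound-skip h , dec-ext (no ¬p) d , judged-σ-abst (⊥-elim ∘ ¬p) j
  inv-skip abbr (h , d , j) ¬p = _ , h , dec-ext (no ¬p) d , judged-σ-abbr (⊥-elim ∘ ¬p) j

  -- The arity context of the body depends on the binder, so the body is passed as a function of an
  -- arbitrary invariant.
  judged-bind : ∀ {L Δ V T} b → Inv L Δ → Judged Γ⟨ L ⟩ Δ ⟦ L ∣ V ⟧ →
                (∀ {Δ′} → Inv (L ,[ b ] V) Δ′ → Judged Γ⟨ L ,[ b ] V ⟩ Δ′ ⟦ L ,[ b ] V ∣ T ⟧) →
                OK L V → Judged Γ⟨ L ⟩ Δ ⟦ L ∣ bind b V T ⟧
  judged-bind abst i k@(a , t , g) f p with f (proj₂ (inv-ext abst i p k))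
  ... | b , u , g′ = a ⊃ b , ∶-ƛ t u , good-ƛ g g′
  judged-bind abbr i k f p = f (proj₂ (inv-ext abbr i p k))

  judged : ∀ {L Δ T} → Inv L Δ → OK L T → Judged Γ⟨ L ⟩ Δ ⟦ L ∣ T ⟧
  judged i ok-sort           = ο , ∶-⋆ , good-⋆
  judged i p@(ok-zero _)     = proj₂ (proj₂ i) zero p
  judged i p@(ok-suc _)      = proj₂ (proj₂ i) _ p
  judged i (ok-bind {b = b} {T = T} p q) = judged-bind {T = T} b i (judged i p) (λ i′ → judged i′ q) p
  judged i (ok-cast p q e)   = judged i q
  judged i (ok-app p q f)    = judged-▸ (proj₁ i) (judged i p) (judged i q) f

  typable : ∀ {L T} → OK L T → ∃ λ U → HasType next A L T U
  typable p with progress p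
  -- The type is a degree-1 reduct of `T`, valid by subject reduction, and serves as its own common
  -- reduct.
  ... | U , s = U , v-cast (ok⇒valid (proj₁ (preserve* p s))) (ok⇒valid p) (U , s , s-refl)

  module _ (_≟_ : DecidableEquality S) (A-dec : ∀ n₁ → Dec (∃ λ n₂ → A n₂ × n₁ ≤ n₂)) where

    ok-dec : ∀ {L Δ} → Inv L Δ → ∀ T → Dec (OK L T)
    ok-dec i (sort s) = yes ok-sort
    ok-dec i (var j)  = proj₁ (proj₂ i) j
    ok-dec i (app V T) with ok-dec i V | ok-dec i T
    ... | no ¬p | _     = no λ { (ok-app p _ _) → ¬p p }
    ... | _     | no ¬q = no λ { (ok-app _ q _) → ¬q q }
    ... | yes p | yes q =
      map′ (ok-app p q) (λ { (ok-app _ _ f) → f })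
        (isFun-dec _≟_ A-dec (proj₁ i) (judged i p) (judged i q))
    ok-dec i (bind b V T) with ok-dec i V
    ... | no ¬p = no λ { (ok-bind p _) → ¬p p }
    ... | yes p =
      map′ (ok-bind p) (λ { (ok-bind _ q) → q }) (ok-dec (proj₂ (inv-ext b i p (judged i p))) T)
    ok-dec i (cast U T) with ok-dec i U | ok-dec i T
    ... | no ¬p | _     = no λ { (ok-cast p _ _) → ¬p p }
    ... | _     | no ¬q = no λ { (ok-cast _ q _) → ¬q q }
    ... | yes p | yes q =
      map′ (ok-cast p q) (λ { (ok-cast _ _ e) → e })
        (≃-dec _≟_ (judged-ty (proj₁ i) (judged i q)) (judged i p))

    inv : ∀ L → ∃[ Δ ] Inv L Δ
    inv ∅ = (λ _ → nothing) , (λ _ ()) , (λ _ → no λ ()) , λ _ ()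
    inv (L ,[ b ] V) with inv L
    ... | _ , i with ok-dec i V
    ... | yes p = inv-ext b i p (judged i p)
    ... | no ¬p = inv-skip b i ¬p

theorem5p4 : (S : Set) → DecidableEquality S → (next : S → S) → S →
    (A : ℕ → Set) →
    (∀ n₁ → Dec (∃ λ n₂ → A n₂ × n₁ ≤ n₂)) →
    (L : Env {S}) (T : Term {S}) →
    Dec (∃ λ U → HasType next A L T U)
theorem5p4 S _≟_ next s₀ A A-dec L T =
  -- Typability of `T` amounts to its validity: a typing contains it, and `typable` gives the
  -- converse.
  map′ typable (λ { (_ , v-cast _ v _) → valid⇒ok v }) (ok-dec _≟_ A-dec (proj₂ (inv _≟_ A-dec L)) T)
  where open Translation next A s₀
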